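{- Let $\mathcal{M}=(E,\mathcal{T})$ be a simple oriented matroid that is not acyclic, on ground set $E$, with set of topes $\mathcal{T}$. Let $\mathbf{K}_3^{\ast}(\mathcal{M})$ be the family of all tope committees of cardinality three for $\mathcal{M}$, let $\mathbf{max}^+(\mathcal{T})$ be the set of topes of $\mathcal{M}$ whose positive parts are inclusion-maximal, and let $\widehat{L}$ be the lattice of convex subsets of $E$ augmented by the greatest element $\hat{1}:=E$. Then the number of committees of cardinality three for $\mathcal{M}$ whose topes have inclusion-maximal positive parts is $$\#\{\mathcal{K}^{\ast}\in\mathbf{K}_3^{\ast}(\mathcal{M}):\ \mathcal{K}^{\ast}\subseteq\mathbf{max}^+(\mathcal{T})\}=\frac{1}{3}\sum_{\substack{\{D_1,D_2\}\subset\widehat{L}:\\ \{E-D_1,E-D_2\}\subset\widehat{L}^{\mathrm{c}},\\ D_1\wedge D_2=\hat{0}}}\bigl|[D_1\vee D_2,\hat{1}]^{\mathrm{c}}\bigr|,$$ where the sum is over unordered pairs (2-element subsets) $\{D_1,D_2\}$.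
   Context: An oriented matroid is called simple here if it has no loops, no parallel elements and no antiparallel elements. Topes are the maximal covectors, regarded as sign vectors $T\in\{+,-\}^E$. $\mathcal{M}$ is acyclic if it has the tope all of whose components are $+$. For a sign vector $F$, $F^+$ denotes its positive part $\{e\in E: F(e)=+\}$. For $e\in E$, the positive halfspace is $\mathcal{T}_e^+:=\{T\in\mathcal{T}: T(e)=+\}$. A tope committee for $\mathcal{M}$ is a subset $\mathcal{K}^{\ast}\subset\mathcal{T}$ such that $|\mathcal{T}_e^+\cap\mathcal{K}^{\ast}|>\frac12|\mathcal{K}^{\ast}|$ for every $e\in E$. The set $\mathbf{max}^+(\mathcal{T})$ consists of the topes $T\in\mathcal{T}$ such that $T^+$ is maximal with respect to inclusion among the positive parts of topes of $\mathcal{M}$. The symbol $\#$ denotes the number of sets in a family. A subset $A\subset E$ is acyclic if the restriction of $\mathcal{M}$ to $A$ is an acyclic oriented matroid. The convex hull $\mathrm{conv}(A)$ of an acyclic set $A$ is the set of all $b\in E$ such that for every covector $F$ of $\mathcal{M}$, if $F(a)=+$ for all $a\in A$ then $F(b)=+$. An acyclic set $A$ is convex if $\mathrm{conv}(A)=A$. The convex subsets of $E$ ordered by inclusion form a meet-semilattice with least element $\hat{0}$ the empty set; $\widehat{L}$ is this poset with a greatest element $\hat{1}:=E$ adjoined. It is a lattice, with meet $\wedge$ and join $\vee$. For a bounded poset $P$, $P^{\mathrm{c}}$ denotes its set of coatoms (elements covered by the greatest element of $P$). A one-element poset has no coatoms, and for a two-element chain $x<y$ one has $\{x,y\}^{\mathrm{c}}=\{x\}$.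 For $x\le z$ in $P$, $[x,z]:=\{y\in P: x\le y\le z\}$ is the closed interval, so $[x,\hat{1}]^{\mathrm{c}}$ is the set of coatoms of the interval $[x,\hat{1}]$ regarded as a bounded poset. -}

module Defs where

open import Level using (0ℓ)
open import Data.Bool.Base using (true; false)
import Data.Bool.Properties as Bool
open import Data.Empty using (⊥-elim)
open import Data.Fin.Base using (Fin; zero; suc)
open import Data.Fin.Properties using (all?)
open import Data.Fin.Subset
  using (Subset; inside; outside; _∈_; _⊆_; _∩_; ∁; ∣_∣)
  renaming (⊤ to full; ⊥ to ∅)
open import Data.Fin.Subset.Properties
  using (_⊆?_; _∈?_; anySubset?; ⊆-antisym; ∈⊤; ⊥⊆; ⊆⊤;
         p∩q⊆p; p∩q⊆q; x∈p∩q⁺; ∩-identityˡ; ∩-identityʳ; ∉⊥)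
open import Data.List.Base
  using (List; []; _∷_; [_]; map; filter; length; cartesianProductWith; _++_)
import Data.List.Base as List
open import Data.List.Membership.Propositional using () renaming (_∈_ to _∈ˡ_)
open import Data.List.Membership.Propositional.Properties
  using (∈-cartesianProductWith⁺)
import Data.List.Relation.Unary.All as All
open import Data.List.Relation.Unary.All.Properties using (all-filter)
import Data.List.Relation.Unary.Any as Any
open import Data.List.Membership.Propositional using (find; lose)
open import Data.Nat.Base using (ℕ; zero; suc; _*_; _<_)
import Data.Nat.Properties as ℕ
open import Data.Product.Base using (∃; _×_; _,_; proj₁; proj₂)
open import Data.Sum.Base using (_⊎_; inj₁; inj₂)
open import Data.Vec.Base
  using (Vec; []; _∷_; lookup; replicate; zipWith; tabulate; here; there)
import Data.Vec.Base as Vec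
open import Data.Vec.Properties
  using (≡-dec; lookup∘tabulate; tabulate∘lookup; tabulate-cong; lookup-map;
         lookup-zipWith; lookup-replicate; []=⇒lookup; lookup⇒[]=)
open import Function.Base using (_∘_; _on_)
open import Relation.Binary.Bundles using (Poset)
open import Relation.Binary.Definitions using (DecidableEquality)
open import Relation.Binary.Lattice.Bundles using (BoundedLattice)
import Relation.Binary.Construct.NonStrictToStrict as Strict
open import Relation.Binary.PropositionalEquality
  using (_≡_; _≢_; refl; sym; trans; cong; cong₂; subst)
open import Relation.Nullary using (¬_; Dec; yes; no; does)
open import Relation.Nullary.Decidable
  using (_×-dec_; _⊎-dec_; _→-dec_; ¬?; map′; decidable-stable)
open import Relation.Unary using (Pred; Decidable; U)

data Sgn : Set where
  ⊕ ⊖ 𝟎 : Sgn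

infix 4 _≟_
_≟_ : DecidableEquality Sgn
⊕ ≟ ⊕ = yes refl
⊕ ≟ ⊖ = no λ ()
⊕ ≟ 𝟎 = no λ ()
⊖ ≟ ⊕ = no λ ()
⊖ ≟ ⊖ = yes refl
⊖ ≟ 𝟎 = no λ ()
𝟎 ≟ ⊕ = no λ ()
𝟎 ≟ ⊖ = no λ ()
𝟎 ≟ 𝟎 = yes refl

-ₛ_ : Sgn → Sgn
-ₛ ⊕ = ⊖
-ₛ ⊖ = ⊕
-ₛ 𝟎 = 𝟎

_∘ₛ_ : Sgn → Sgn → Sgn
⊕ ∘ₛ _ = ⊕
⊖ ∘ₛ _ = ⊖
𝟎 ∘ₛ t = t

SignVec : ℕ → Set
SignVec n = Vec Sgn n

private variable
  n : ℕ

-ᵥ_ : SignVec n → SignVec n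
-ᵥ_ = Vec.map -ₛ_

infixr 7 _∘ᵥ_
_∘ᵥ_ : SignVec n → SignVec n → SignVec n
_∘ᵥ_ = zipWith _∘ₛ_

Separates : SignVec n → SignVec n → Fin n → Set
Separates X Y e = lookup X e ≢ 𝟎 × lookup X e ≡ -ₛ lookup Y e

infix 4 _≼_
_≼_ : SignVec n → SignVec n → Set
X ≼ Y = ∀ e → lookup X e ≡ 𝟎 ⊎ lookup X e ≡ lookup Y e

vecs : {A : Set} → List A → ∀ n → List (Vec A n)
vecs xs zero    = [ [] ]
vecs xs (suc n) = cartesianProductWith _∷_ xs (vecs xs n)

subsets : ∀ n → List (Subset n)
subsets = vecs (inside ∷ outside ∷ [])

signVecs : ∀ n → List (SignVec n)
signVecs = vecs (⊕ ∷ ⊖ ∷ 𝟎 ∷ [])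

∈-signVecs : (X : SignVec n) → X ∈ˡ signVecs n
∈-signVecs []      = Any.here refl
∈-signVecs (s ∷ X) = ∈-cartesianProductWith⁺ _∷_ (∈-sgn s) (∈-signVecs X)
  where
  ∈-sgn : ∀ s → s ∈ˡ (⊕ ∷ ⊖ ∷ 𝟎 ∷ [])
  ∈-sgn ⊕ = Any.here refl
  ∈-sgn ⊖ = Any.there (Any.here refl)
  ∈-sgn 𝟎 = Any.there (Any.there (Any.here refl))

anySignVec? : {P : Pred (SignVec n) 0ℓ} → Decidable P → Dec (∃ P)
anySignVec? {n = n} P? = map′ (λ a → let X , _ , p = find a in X , p)
                              (λ (X , p) → lose (∈-signVecs X) p)
                              (Any.any? P? (signVecs n))

module _ {A : Set} (any : {P : Pred A 0ℓ} → Decidable P → Dec (∃ P)) where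

  ∃?⇒∀? : {P : Pred A 0ℓ} → Decidable P → Dec (∀ x → P x)
  ∃?⇒∀? P? = map′ (λ ∄ x → decidable-stable (P? x) λ ¬p → ∄ (x , ¬p))
                  (λ ∀P (x , ¬p) → ¬p (∀P x))
                  (¬? (any (¬? ∘ P?)))

allSignVec? : {P : Pred (SignVec n) 0ℓ} → Decidable P → Dec (∀ X → P X)
allSignVec? = ∃?⇒∀? anySignVec?

allSubset? : {P : Pred (Subset n) 0ℓ} → Decidable P → Dec (∀ A → P A)
allSubset? = ∃?⇒∀? anySubset?

infix 4 _≡ᵈ_
_≡ᵈ_ : DecidableEquality (Subset n)
_≡ᵈ_ = ≡-dec Bool._≟_

-- The subset { i ∣ P i }.
⟦_⟧ : {P : Pred (Fin n) 0ℓ} → Decidable P → Subset n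
⟦ P? ⟧ = tabulate (does ∘ P?)

module _ {P : Pred (Fin n) 0ℓ} (P? : Decidable P) where

  ∈⟦⟧⁺ : ∀ {i} → P i → i ∈ ⟦ P? ⟧
  ∈⟦⟧⁺ {i} p = lookup⇒[]= i ⟦ P? ⟧ (trans (lookup∘tabulate _ i) eq)
    where
    eq : does (P? i) ≡ true
    eq with P? i
    ... | yes _ = refl
    ... | no ¬p = ⊥-elim (¬p p)

  ∈⟦⟧⁻ : ∀ {i} → i ∈ ⟦ P? ⟧ → P i
  ∈⟦⟧⁻ {i} i∈ = eq (trans (sym (lookup∘tabulate _ i)) ([]=⇒lookup i∈))
    where
    eq : does (P? i) ≡ true → P i
    eq with P? i
    ... | yes p = λ _ → p
    ... | no _  = λ ()

infix 8 _⁺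
_⁺ : SignVec n → Subset n
X ⁺ = ⟦ (λ e → lookup X e ≟ ⊕) ⟧

-- For a duplicate-free list, each 2-element subset occurs exactly once.
pairs : {A : Set} → List A → List (A × A)
pairs []       = []
pairs (x ∷ xs) = map (x ,_) xs ++ pairs xs

-- The ground set is Fin n; the axioms are the covector axioms.
record OrientedMatroid (n : ℕ) : Set₁ where
  field
    Covector  : Pred (SignVec n) 0ℓ
    covector? : Decidable Covector
    zero-cov  : Covector (replicate n 𝟎)
    neg-cov   : ∀ {X} → Covector X → Covector (-ᵥ X)
    comp-cov  : ∀ {X Y} → Covector X → Covector Y → Covector (X ∘ᵥ Y)
    elim-cov  : ∀ {X Y} → Covector X → Covector Y → ∀ e → Separates X Y e →
                ∃ λ Z → Covector Z × lookup Z e ≡ 𝟎 ×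
                  (∀ f → ¬ Separates X Y f → lookup Z f ≡ lookup (X ∘ᵥ Y) f)

open OrientedMatroid

Tope : OrientedMatroid n → Pred (SignVec n) 0ℓ
Tope M T = Covector M T × (∀ X → Covector M X → T ≼ X → T ≡ X)

IsAcyclic : OrientedMatroid n → Set
IsAcyclic {n} M = Tope M (replicate n ⊕)

record Simple (M : OrientedMatroid n) : Set where
  field
    no-loops        : ∀ e → ¬ (∀ X → Covector M X → lookup X e ≡ 𝟎)
    no-parallel     : ∀ e f → e ≢ f →
                      ¬ (∀ X → Covector M X → lookup X e ≡ lookup X f)
    no-antiparallel : ∀ e f → e ≢ f →
                      ¬ (∀ X → Covector M X → lookup X e ≡ -ₛ lookup X f)

-- The increasing bijection from Fin ∣ A ∣ onto A.
embed : (A : Subset n) → Fin ∣ A ∣ → Fin n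
embed (inside  ∷ A) zero    = zero
embed (inside  ∷ A) (suc i) = suc (embed A i)
embed (outside ∷ A) i       = suc (embed A i)

embed-∈ : (A : Subset n) (i : Fin ∣ A ∣) → embed A i ∈ A
embed-∈ (inside  ∷ A) zero    = here
embed-∈ (inside  ∷ A) (suc i) = there (embed-∈ A i)
embed-∈ (outside ∷ A) i       = there (embed-∈ A i)

embed-surj : (A : Subset n) {e : Fin n} → e ∈ A → ∃ λ i → embed A i ≡ e
embed-surj (inside  ∷ A) here       = zero , refl
embed-surj (inside  ∷ A) (there e∈) =
  let i , eq = embed-surj A e∈ in suc i , cong suc eq
embed-surj (outside ∷ A) (there e∈) =
  let i , eq = embed-surj A e∈ in i , cong suc eq

restrict : (A : Subset n) → SignVec n → SignVec ∣ A ∣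
restrict A X = tabulate (lookup X ∘ embed A)

lookup-restrict : (A : Subset n) (X : SignVec n) (i : Fin ∣ A ∣) →
                  lookup (restrict A X) i ≡ lookup X (embed A i)
lookup-restrict A X i = lookup∘tabulate _ i

vec-ext : {m : ℕ} {X Y : SignVec m} →
          (∀ i → lookup X i ≡ lookup Y i) → X ≡ Y
vec-ext {X = X} {Y} eq =
  trans (sym (tabulate∘lookup X)) (trans (tabulate-cong eq) (tabulate∘lookup Y))

restrict-neg : (A : Subset n) (X : SignVec n) →
               restrict A (-ᵥ X) ≡ -ᵥ restrict A X
restrict-neg A X = vec-ext λ i →
  trans (lookup-restrict A (-ᵥ X) i)
  (trans (lookup-map (embed A i) -ₛ_ X)
  (trans (cong -ₛ_ (sym (lookup-restrict A X i)))
         (sym (lookup-map i -ₛ_ (restrict A X)))))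

restrict-comp : (A : Subset n) (X Y : SignVec n) →
                restrict A (X ∘ᵥ Y) ≡ restrict A X ∘ᵥ restrict A Y
restrict-comp A X Y = vec-ext λ i →
  trans (lookup-restrict A (X ∘ᵥ Y) i)
  (trans (lookup-zipWith _∘ₛ_ (embed A i) X Y)
  (trans (cong₂ _∘ₛ_ (sym (lookup-restrict A X i)) (sym (lookup-restrict A Y i)))
         (sym (lookup-zipWith _∘ₛ_ i (restrict A X) (restrict A Y)))))

restrict-zero : ∀ {n} (A : Subset n) → restrict A (replicate n 𝟎) ≡ replicate ∣ A ∣ 𝟎
restrict-zero {n} A = vec-ext λ i →
  trans (lookup-restrict A (replicate n 𝟎) i)
  (trans (lookup-replicate (embed A i) 𝟎) (sym (lookup-replicate i 𝟎)))

separates-restrict : (A : Subset n) (X Y : SignVec n) (i : Fin ∣ A ∣) →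
                     Separates (restrict A X) (restrict A Y) i →
                     Separates X Y (embed A i)
separates-restrict A X Y i (≢𝟎 , eq)
  rewrite lookup-restrict A X i | lookup-restrict A Y i = ≢𝟎 , eq

restrict-separates : (A : Subset n) (X Y : SignVec n) (i : Fin ∣ A ∣) →
                     Separates X Y (embed A i) →
                     Separates (restrict A X) (restrict A Y) i
restrict-separates A X Y i s
  rewrite lookup-restrict A X i | lookup-restrict A Y i = s

infix 6 _↾_
_↾_ : OrientedMatroid n → (A : Subset n) → OrientedMatroid ∣ A ∣
_↾_ {n} M A = record
  { Covector  = λ Y → ∃ λ X → Covector M X × restrict A X ≡ Y
  ; covector? = λ Y → anySignVec? λ X →
                  covector? M X ×-dec ≡-dec _≟_ (restrict A X) Y
  ; zero-cov  = replicate n 𝟎 , zero-cov M , restrict-zero A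
  ; neg-cov   = λ { (X , c , refl) → -ᵥ X , neg-cov M c , restrict-neg A X }
  ; comp-cov  = λ { (X , c , refl) (Y , d , refl) →
                    X ∘ᵥ Y , comp-cov M c d , restrict-comp A X Y }
  ; elim-cov  = λ { (X , c , refl) (Y , d , refl) i s →
      let Z , z , Z≡𝟎 , agree =
            elim-cov M c d (embed A i) (separates-restrict A X Y i s)
      in restrict A Z , (Z , z , refl)
       , trans (lookup-restrict A Z i) Z≡𝟎
       , λ j ¬s →
           trans (lookup-restrict A Z j)
           (trans (agree (embed A j) (¬s ∘ restrict-separates A X Y j))
           (trans (sym (lookup-restrict A (X ∘ᵥ Y) j))
                  (cong (λ V → lookup V j) (restrict-comp A X Y)))) }
  }

≼? : (X Y : SignVec n) → Dec (X ≼ Y)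
≼? X Y = all? λ e → (lookup X e ≟ 𝟎) ⊎-dec (lookup X e ≟ lookup Y e)

tope? : (M : OrientedMatroid n) → Decidable (Tope M)
tope? M T = covector? M T ×-dec
  allSignVec? λ X → covector? M X →-dec (≼? T X →-dec ≡-dec _≟_ T X)

Acyclic : OrientedMatroid n → Pred (Subset n) 0ℓ
Acyclic M A = IsAcyclic (M ↾ A)

InConv : OrientedMatroid n → Subset n → Pred (Fin n) 0ℓ
InConv M A b = ∀ F → Covector M F →
               (∀ a → a ∈ A → lookup F a ≡ ⊕) → lookup F b ≡ ⊕

inConv? : (M : OrientedMatroid n) (A : Subset n) → Decidable (InConv M A)
inConv? M A b = allSignVec? λ F → covector? M F →-dec
  ((all? λ a → (a ∈? A) →-dec (lookup F a ≟ ⊕)) →-dec (lookup F b ≟ ⊕))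

conv : OrientedMatroid n → Subset n → Subset n
conv M A = ⟦ inConv? M A ⟧

Convex : OrientedMatroid n → Pred (Subset n) 0ℓ
Convex M A = Acyclic M A × conv M A ≡ A

convex? : (M : OrientedMatroid n) → Decidable (Convex M)
convex? M A = tope? (M ↾ A) _ ×-dec (conv M A ≡ᵈ A)

acyclic⁻ : (M : OrientedMatroid n) {A : Subset n} → Acyclic M A →
           ∃ λ X → Covector M X × (∀ a → a ∈ A → lookup X a ≡ ⊕)
acyclic⁻ M {A} ((X , c , eq) , _) = X , c , λ a a∈ → plus (embed-surj A a∈)
  where
  plus : ∀ {a} → (∃ λ i → embed A i ≡ a) → lookup X a ≡ ⊕
  plus (i , refl) = trans (sym (lookup-restrict A X i))
    (trans (cong (λ V → lookup V i) eq) (lookup-replicate i ⊕))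

acyclic⁺ : (M : OrientedMatroid n) {A : Subset n} →
           (∃ λ X → Covector M X × (∀ a → a ∈ A → lookup X a ≡ ⊕)) → Acyclic M A
acyclic⁺ M {A} (X , c , plus) =
  (X , c , vec-ext λ i → trans (lookup-restrict A X i)
    (trans (plus _ (embed-∈ A i)) (sym (lookup-replicate i ⊕))))
  , λ Y _ ≤Y → vec-ext λ i → maximal i (lookup-replicate i ⊕) (≤Y i)
  where
  maximal : ∀ {s t} (i : Fin ∣ A ∣) → s ≡ ⊕ → s ≡ 𝟎 ⊎ s ≡ t → s ≡ t
  maximal i refl (inj₂ eq) = eq

acyclic-⊆ : (M : OrientedMatroid n) {A B : Subset n} →
            A ⊆ B → Acyclic M B → Acyclic M A
acyclic-⊆ M A⊆B acB =
  let X , c , plus = acyclic⁻ M acB in acyclic⁺ M (X , c , λ a a∈ → plus a (A⊆B a∈))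

⊆conv : (M : OrientedMatroid n) (A : Subset n) → A ⊆ conv M A
⊆conv M A a∈ = ∈⟦⟧⁺ (inConv? M A) (λ F _ plus → plus _ a∈)

conv-mono : (M : OrientedMatroid n) {A B : Subset n} →
            A ⊆ B → conv M A ⊆ conv M B
conv-mono M {A} {B} A⊆B b∈ = ∈⟦⟧⁺ (inConv? M B) λ F c plus →
  ∈⟦⟧⁻ (inConv? M A) b∈ F c (λ a a∈ → plus a (A⊆B a∈))

convex-by : (M : OrientedMatroid n) {A : Subset n} →
            Acyclic M A → conv M A ⊆ A → Convex M A
convex-by M {A} ac sub = ac , ⊆-antisym sub (⊆conv M A)

conv⊆ : (M : OrientedMatroid n) {A C : Subset n} →
        Convex M C → A ⊆ C → conv M A ⊆ C
conv⊆ M (_ , eq) A⊆C b∈ = subst (_ ∈_) eq (conv-mono M A⊆C b∈)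

∅-convex : (M : OrientedMatroid n) → Convex M ∅
∅-convex {n} M = convex-by M
  (acyclic⁺ M (replicate n 𝟎 , zero-cov M , λ a a∈ → ⊥-elim (∉⊥ a∈)))
  λ {b} b∈ → ⊥-elim (𝟎≢⊕ (trans (sym (lookup-replicate b 𝟎))
      (∈⟦⟧⁻ (inConv? M ∅) b∈ (replicate n 𝟎) (zero-cov M)
        λ a a∈ → ⊥-elim (∉⊥ a∈))))
  where
  𝟎≢⊕ : 𝟎 ≢ ⊕
  𝟎≢⊕ ()

-- full is convex only when M is acyclic, so for M not acyclic it is
-- genuinely adjoined.
InL̂ : OrientedMatroid n → Pred (Subset n) 0ℓ
InL̂ M A = Convex M A ⊎ A ≡ full

inL̂? : (M : OrientedMatroid n) → Decidable (InL̂ M)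
inL̂? M A = convex? M A ⊎-dec (A ≡ᵈ full)

∩-InL̂ : (M : OrientedMatroid n) {A B : Subset n} →
        InL̂ M A → InL̂ M B → InL̂ M (A ∩ B)
∩-InL̂ M {A} {B} (inj₁ a) (inj₁ b) = inj₁ (convex-by M
  (acyclic-⊆ M (p∩q⊆p A B) (proj₁ a))
  λ x∈ → x∈p∩q⁺ (conv⊆ M a (p∩q⊆p A B) x∈ , conv⊆ M b (p∩q⊆q A B) x∈))
∩-InL̂ M {A} (inj₁ a) (inj₂ refl) = subst (InL̂ M) (sym (∩-identityʳ A)) (inj₁ a)
∩-InL̂ M {_} {B} (inj₂ refl) b = subst (InL̂ M) (sym (∩-identityˡ B)) b

UpperBound : OrientedMatroid n → Subset n → Subset n → Pred (Subset n) 0ℓ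
UpperBound M A B C = InL̂ M C × A ⊆ C × B ⊆ C

upperBound? : (M : OrientedMatroid n) (A B : Subset n) →
              Decidable (UpperBound M A B)
upperBound? M A B C = inL̂? M C ×-dec (A ⊆? C) ×-dec (B ⊆? C)

inJoin? : (M : OrientedMatroid n) (A B : Subset n) →
          Decidable (λ e → ∀ C → UpperBound M A B C → e ∈ C)
inJoin? M A B e = allSubset? λ C → upperBound? M A B C →-dec (e ∈? C)

-- The intersection of all members of L̂ containing A and B.
join : OrientedMatroid n → Subset n → Subset n → Subset n
join M A B = ⟦ inJoin? M A B ⟧

join⊆ : (M : OrientedMatroid n) {A B C : Subset n} →
        UpperBound M A B C → join M A B ⊆ C
join⊆ M {A} {B} ub e∈ = ∈⟦⟧⁻ (inJoin? M A B) e∈ _ ub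

join-InL̂ : (M : OrientedMatroid n) (A B : Subset n) → InL̂ M (join M A B)
join-InL̂ M A B with anySubset? (λ C → convex? M C ×-dec upperBound? M A B C)
... | yes (C , cC , ub) = inj₁ (convex-by M
        (acyclic-⊆ M (join⊆ M ub) (proj₁ cC))
        λ {b} b∈ → ∈⟦⟧⁺ (inJoin? M A B) λ where
          D ub@(inj₁ cD , _)   → conv⊆ M cD (join⊆ M ub) b∈
          D (inj₂ refl , _)    → ∈⊤)
... | no ∄ = inj₂ (⊆-antisym ⊆⊤ λ {e} _ → ∈⟦⟧⁺ (inJoin? M A B) λ where
          D ub@(inj₁ cD , _)   → ⊥-elim (∄ (D , cD , ub))
          D (inj₂ refl , _)    → ∈⊤)

L̂ : OrientedMatroid n → BoundedLattice 0ℓ 0ℓ 0ℓ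
L̂ {n} M = record
  { Carrier = ∃ (InL̂ M)
  ; _≈_     = _≡_ on proj₁
  ; _≤_     = _⊆_ on proj₁
  ; _∨_     = λ (A , _) (B , _) → join M A B , join-InL̂ M A B
  ; _∧_     = λ (A , a) (B , b) → A ∩ B , ∩-InL̂ M a b
  ; ⊤       = full , inj₂ refl
  ; ⊥       = ∅ , inj₁ (∅-convex M)
  ; isBoundedLattice = record
    { isLattice = record
      { isPartialOrder = record
        { isPreorder = record
          { isEquivalence = record { refl = refl ; sym = sym ; trans = trans }
          ; reflexive     = λ { refl → λ x∈ → x∈ }
          ; trans         = λ A⊆B B⊆C x∈ → B⊆C (A⊆B x∈)
          }
        ; antisym = λ A⊆B B⊆A → ⊆-antisym A⊆B B⊆A
        }
      ; supremum = λ (A , _) (B , _) →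
            (λ x∈ → ∈⟦⟧⁺ (inJoin? M A B) λ C (_ , A⊆C , _) → A⊆C x∈)
          , (λ x∈ → ∈⟦⟧⁺ (inJoin? M A B) λ C (_ , _ , B⊆C) → B⊆C x∈)
          , λ (C , c) A⊆C B⊆C → join⊆ M (c , A⊆C , B⊆C)
      ; infimum  = λ (A , _) (B , _) →
            p∩q⊆p A B
          , p∩q⊆q A B
          , λ (C , _) C⊆A C⊆B x∈ → x∈p∩q⁺ (C⊆A x∈ , C⊆B x∈)
      }
    ; maximum = λ _ → ⊆⊤
    ; minimum = λ _ → ⊥⊆
    }
  }

module _ (P : Poset 0ℓ 0ℓ 0ℓ) where
  open Poset P using (Carrier; _≈_; _≤_)
  open Strict _≈_ _≤_ using () renaming (_<_ to _⊏_)

  Interval : Carrier → Carrier → Pred Carrier 0ℓ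
  Interval x z y = x ≤ y × y ≤ z

  -- The elements covered by z in the subposet Q, whose greatest element is z.
  Coatom : Pred Carrier 0ℓ → Carrier → Pred Carrier 0ℓ
  Coatom Q z y = Q y × y ⊏ z × (∀ w → Q w → ¬ (y ⊏ w × w ⊏ z))

module _ (M : OrientedMatroid n) where
  open BoundedLattice (L̂ M) using (Carrier; poset; ⊤; ⊥; _≈_; _∨_; _∧_)

  -- Each member of L̂ is listed once, with one membership proof; _≈_ ignores
  -- the proofs.
  L̂-elements : List Carrier
  L̂-elements = All.toList (all-filter (inL̂? M) (subsets n))

  L̂ᶜ : Pred Carrier 0ℓ
  L̂ᶜ = Coatom poset U ⊤

  [_,1̂]ᶜ : Carrier → Pred Carrier 0ℓ
  [ x ,1̂]ᶜ = Coatom poset (Interval poset x ⊤) ⊤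

  coatom? : {Q : Pred (Subset n) 0ℓ} → Decidable Q →
            Decidable (Coatom poset (Q ∘ proj₁) ⊤)
  coatom? Q? (A , _) = Q? A ×-dec A ⊏? full ×-dec
    map′ (λ h (C , c) → h C c) (λ h C c → h (C , c))
      (allSubset? λ C → inL̂? M C →-dec
        (Q? C →-dec ¬? (A ⊏? C ×-dec C ⊏? full)))
    where
    infix 8 _⊏?_
    _⊏?_ : (A B : Subset n) → Dec (A ⊆ B × A ≢ B)
    A ⊏? B = (A ⊆? B) ×-dec ¬? (A ≡ᵈ B)

  L̂ᶜ? : Decidable L̂ᶜ
  L̂ᶜ? = coatom? (λ _ → yes _)

  [_,1̂]ᶜ? : (x : Carrier) → Decidable [ x ,1̂]ᶜ
  [ (A , _) ,1̂]ᶜ? = coatom? (λ C → (A ⊆? C) ×-dec (C ⊆? full))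

  infix 4 _∈L̂ᶜ
  _∈L̂ᶜ : Pred (Subset n) 0ℓ
  A ∈L̂ᶜ = ∃ λ (a : InL̂ M A) → L̂ᶜ (A , a)

  _∈L̂ᶜ? : Decidable _∈L̂ᶜ
  A ∈L̂ᶜ? with inL̂? M A
  ... | no ¬a = no (¬a ∘ proj₁)
  ... | yes a = map′ (a ,_) proj₂ (L̂ᶜ? (A , a))

  SummationPair : Pred (Carrier × Carrier) 0ℓ
  SummationPair (D₁ , D₂) =
    ∁ (proj₁ D₁) ∈L̂ᶜ × ∁ (proj₁ D₂) ∈L̂ᶜ × D₁ ∧ D₂ ≈ ⊥

  summationPair? : Decidable SummationPair
  summationPair? (D₁ , D₂) =
    (∁ (proj₁ D₁) ∈L̂ᶜ?) ×-dec (∁ (proj₁ D₂) ∈L̂ᶜ?) ×-dec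
    (proj₁ (D₁ ∧ D₂) ≡ᵈ ∅)

  topes : List (SignVec n)
  topes = filter (tope? M) (signVecs n)

  tope : Fin (length topes) → SignVec n
  tope = List.lookup topes

  -- Sets of topes are subsets of the index set of the duplicate-free
  -- list topes.
  TopeSet : Set
  TopeSet = Subset (length topes)

  𝒯⁺ : Fin n → TopeSet
  𝒯⁺ e = ⟦ (λ i → lookup (tope i) e ≟ ⊕) ⟧

  Committee : Pred TopeSet 0ℓ
  Committee K = ∀ e → ∣ K ∣ < 2 * ∣ 𝒯⁺ e ∩ K ∣

  committee? : Decidable Committee
  committee? K = all? λ e → ∣ K ∣ ℕ.<? 2 * ∣ 𝒯⁺ e ∩ K ∣

  max⁺ : TopeSet
  max⁺ = ⟦ (λ i → all? λ j →
             (tope i ⁺ ⊆? tope j ⁺) →-dec (tope i ⁺ ≡ᵈ tope j ⁺)) ⟧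

  MaxCommittee₃ : Pred TopeSet 0ℓ
  MaxCommittee₃ K = (Committee K × ∣ K ∣ ≡ 3) × K ⊆ max⁺

  maxCommittee₃? : Decidable MaxCommittee₃
  maxCommittee₃? K = (committee? K ×-dec (∣ K ∣ ℕ.≟ 3)) ×-dec (K ⊆? max⁺)

-- The coatoms of L̂ are the positive parts of the topes in max⁺, and distinct
-- topes have distinct positive parts. If E − D is the positive part of the tope T,
-- then D is the positive part of −T, hence convex. Join two topes of max⁺ by an
-- edge when every e ∈ E is positive in at least one of them; M not being acyclic
-- means that there are no loops. A set of three topes is a committee iff every e
-- is negative in at most one of them, i.e. iff they form a triangle of this graph,
-- while the sum counts the edges {T₁, T₂} together with a common neighbour T₃, so
-- it counts each triangle three times. Both sides are compared with the number of
-- ordered triangles: six times the number of committees, and twice the sum.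
module Submission where

open import Defs
import Algebra.Lattice.Properties.BooleanAlgebra as BooleanAlgebra
open import Data.Bool.Base using (if_then_else_; true; false)
open import Data.Empty using (⊥-elim)
open import Data.Fin.Base using (Fin; zero; suc)
open import Data.Fin.Properties using (all?)
open import Data.Fin.Subset using (Subset; inside; outside; _⊆_; _∩_; ∁; ∣_∣) renaming (_∈_ to _∈ₛ_; ⊤ to full; ⊥ to ∅)
open import Data.Fin.Subset.Properties
  using (_∈?_; _⊆?_; ⊆-antisym; ⊆⊤; ⊥⊆; ∈⊤; ∉⊥; x∈p∩q⁺; x∈p∩q⁻; x∈∁p⇒x∉p;
         x∉p⇒x∈∁p; x∉∁p⇒x∈p; ∩-idem; ∩-comm; ∪-∩-booleanAlgebra)
open import Data.Integer.Base using (+_) renaming (_*_ to infixl 7 _ℤ*_)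
import Data.Integer.Properties as ℤ
open import Data.List.Base using (List; []; _∷_; _++_; length; filter; map; allFin; tabulate)
import Data.List.Base as List
open import Data.List.Membership.Propositional using (_∈_)
open import Data.List.Membership.Propositional.Properties
  using (∈-filter⁺; ∈-filter⁻; ∈-map⁺; ∈-map⁻; ∈-lookup; ∈-allFin; ∈-cartesianProductWith⁺)
open import Data.List.Membership.Propositional.Properties.WithK using (unique∧set⇒bag)
open import Data.List.Properties using (map-cong; map-++; map-∘; map-tabulate; length-map; ++-identityʳ)
open import Data.List.Relation.Binary.BagAndSetEquality using (∼bag⇒↭)
open import Data.List.Relation.Binary.Permutation.Propositional.Properties using () renaming (map⁺ to ↭-map⁺)
import Data.List.Relation.Unary.All as All
open import Data.List.Relation.Unary.All.Properties using (all-filter)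
open import Data.List.Relation.Unary.AllPairs using ([]; _∷_)
open import Data.List.Relation.Unary.Any using (here; there; index)
open import Data.List.Relation.Unary.Any.Properties using (lookup-index)
open import Data.List.Relation.Unary.Unique.Propositional using (Unique)
import Data.List.Relation.Unary.Unique.Propositional.Properties as Unique
open import Data.Nat.Base using (ℕ; zero; suc; _+_; _<_; s≤s; z≤n) renaming (_*_ to infixl 7 _·_)
open import Data.Nat.ListAction using (sum)
open import Data.Nat.ListAction.Properties using (sum-++; sum-↭)
import Data.Nat.Properties as ℕ
open import Data.Nat.Tactic.RingSolver using (solve-∀)
open import Data.Product.Base using (∃; _×_; _,_; proj₁; proj₂; uncurry)
open import Data.Rational.Base using (_/_; _*_)
open import Data.Rational.Properties using (toℚᵘ-injective; toℚᵘ-homo-*; toℚᵘ-fromℚᵘ)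
open import Data.Rational.Unnormalised.Base using (mkℚᵘ; *≡*)
import Data.Rational.Unnormalised.Properties as ℚᵘ
open import Data.Sum.Base using (_⊎_; inj₁; inj₂; swap; reduce)
open import Data.Unit.Base using (tt)
open import Data.Vec.Base using (Vec; []; _∷_; lookup; replicate; here; there)
open import Data.Vec.Properties using (∷-injective; lookup-zipWith; lookup-replicate; lookup-map)
open import Function.Base using (_∘_; id)
open import Function.Bundles using (_⇔_; mk⇔; Equivalence)
open import Level using (0ℓ)
open import Relation.Binary.Lattice.Bundles using (BoundedLattice)
open import Relation.Binary.PropositionalEquality
open import Relation.Nullary using (¬_; Dec; yes; no; does)
open import Relation.Nullary.Decidable using (does-⇔; ¬?; decidable-stable; _×-dec_; _⊎-dec_; _→-dec_)
open import Relation.Unary using (Pred; Decidable)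

open ≡-Reasoning

private variable
  A B : Set
  P Q : Set
  n : ℕ

-- Sums over lists and their sublists

𝟙 : Dec P → ℕ
𝟙 d = if does d then 1 else 0

𝟙-cong : P ⇔ Q → (p : Dec P) (q : Dec Q) → 𝟙 p ≡ 𝟙 q
𝟙-cong P⇔Q p q = cong (if_then 1 else 0) (does-⇔ P⇔Q p q)

𝟙-zero : ¬ P → (p : Dec P) → 𝟙 p ≡ 0
𝟙-zero ¬p (yes p) = ⊥-elim (¬p p)
𝟙-zero ¬p (no _)  = refl

∑ : List A → (A → ℕ) → ℕ
∑ xs f = sum (map f xs)

∑-cong : {f g : A → ℕ} → (∀ x → f x ≡ g x) → ∀ xs → ∑ xs f ≡ ∑ xs g
∑-cong f≗g xs = cong sum (map-cong f≗g xs)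

∑-zero : {f : A → ℕ} → (∀ x → f x ≡ 0) → ∀ xs → ∑ xs f ≡ 0
∑-zero f≗0 []       = refl
∑-zero f≗0 (x ∷ xs) = cong₂ _+_ (f≗0 x) (∑-zero f≗0 xs)

∑-+ : (f g : A → ℕ) → ∀ xs → ∑ xs (λ x → f x + g x) ≡ ∑ xs f + ∑ xs g
∑-+ f g []       = refl
∑-+ f g (x ∷ xs) = begin
  f x + g x + ∑ xs (λ x → f x + g x)  ≡⟨ cong (λ s → f x + g x + s) (∑-+ f g xs) ⟩
  f x + g x + (∑ xs f + ∑ xs g)       ≡⟨ interchange (f x) (g x) _ _ ⟩
  f x + ∑ xs f + (g x + ∑ xs g)       ∎
  where
  interchange : ∀ a b c d → a + b + (c + d) ≡ a + c + (b + d)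
  interchange = solve-∀

∑-++ : (f : A → ℕ) → ∀ xs ys → ∑ (xs ++ ys) f ≡ ∑ xs f + ∑ ys f
∑-++ f xs ys = trans (cong sum (map-++ f xs ys)) (sum-++ (map f xs) _)

∑-map : (f : B → ℕ) (g : A → B) → ∀ xs → ∑ (map g xs) f ≡ ∑ xs (f ∘ g)
∑-map f g xs = cong sum (sym (map-∘ xs))

∑-filter : {R : Pred A 0ℓ} (R? : Decidable R) (f : A → ℕ) → ∀ xs →
           ∑ (filter R? xs) f ≡ ∑ xs (λ x → 𝟙 (R? x) · f x)
∑-filter R? f []       = refl
∑-filter R? f (x ∷ xs) with does (R? x)
... | true  = cong₂ _+_ (sym (ℕ.+-identityʳ (f x))) (∑-filter R? f xs)
... | false = ∑-filter R? f xs

length-filter : {R : Pred A 0ℓ} (R? : Decidable R) → ∀ xs →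
                length (filter R? xs) ≡ ∑ xs (𝟙 ∘ R?)
length-filter R? []       = refl
length-filter R? (x ∷ xs) with does (R? x)
... | true  = cong suc (length-filter R? xs)
... | false = length-filter R? xs

-- Zero terms can be discarded on both sides. What remains of `xs` and of `map h ys` are two
-- duplicate-free lists with the same members, hence permutations of each other. The alternative
-- `f x ≡ 0` in the covering hypothesis lets `xs` have entries outside the image of `h`.
∑-reindex : {xs : List A} {ys : List B} (f : A → ℕ) (h : B → A) →
            Unique xs → Unique ys → (∀ {y z} → h y ≡ h z → y ≡ z) →
            (∀ y → y ∈ ys → h y ∈ xs) →
            (∀ x → (∃ λ y → y ∈ ys × h y ≡ x) ⊎ f x ≡ 0) →
            ∑ xs f ≡ ∑ ys (f ∘ h)
∑-reindex {A} {xs = xs} {ys} f h xs! ys! h-inj h∈ cover = begin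
  ∑ xs f                         ≡⟨ ∑-support xs ⟨
  ∑ (filter supp? xs) f          ≡⟨ sum-↭ (↭-map⁺ f (∼bag⇒↭ (unique∧set⇒bag
                                      (Unique.filter⁺ supp? xs!)
                                      (Unique.filter⁺ supp? (Unique.map⁺ h-inj ys!))
                                      (mk⇔ to from)))) ⟩
  ∑ (filter supp? (map h ys)) f  ≡⟨ ∑-support (map h ys) ⟩
  ∑ (map h ys) f                 ≡⟨ ∑-map f h ys ⟩
  ∑ ys (f ∘ h)                   ∎
  where
  supp? : Decidable (λ x → f x ≢ 0)
  supp? x = ¬? (f x ℕ.≟ 0)

  ∑-support : ∀ zs → ∑ (filter supp? zs) f ≡ ∑ zs f
  ∑-support zs = trans (∑-filter supp? f zs) (∑-cong value zs)
    where
    value : ∀ x → 𝟙 (supp? x) · f x ≡ f x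
    value x with f x
    ... | zero  = refl
    ... | suc m = ℕ.+-identityʳ (suc m)

  to : ∀ {x} → x ∈ filter supp? xs → x ∈ filter supp? (map h ys)
  to {x} x∈ with cover x | ∈-filter⁻ supp? {xs = xs} x∈
  ... | inj₁ (y , y∈ , refl) | _ , fx≢0 = ∈-filter⁺ supp? (∈-map⁺ h y∈) fx≢0
  ... | inj₂ fx≡0            | _ , fx≢0 = ⊥-elim (fx≢0 fx≡0)

  from : ∀ {x} → x ∈ filter supp? (map h ys) → x ∈ filter supp? xs
  from x∈ with ∈-filter⁻ supp? {xs = map h ys} x∈
  ... | x∈map , fx≢0 with ∈-map⁻ h x∈map
  ... | y , y∈ , refl = ∈-filter⁺ supp? (h∈ y y∈) fx≢0

sublists : List A → List (List A)
sublists []       = [] ∷ []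
sublists (x ∷ xs) = map (x ∷_) (sublists xs) ++ sublists xs

∑-sublists-∷ : (φ : List A → ℕ) → ∀ x xs →
               ∑ (sublists (x ∷ xs)) φ ≡ ∑ (sublists xs) (φ ∘ (x ∷_)) + ∑ (sublists xs) φ
∑-sublists-∷ φ x xs = trans (∑-++ φ (map (x ∷_) (sublists xs)) _)
                            (cong (_+ _) (∑-map φ (x ∷_) (sublists xs)))

-- Each `only` function vanishes on lists of the wrong length, so its sum over all sublists is a sum
-- over sublists of one fixed length. Fixing the head turns `only₃ f` into `only₂ (f x)` by
-- definition, which is what the inductions below use.
only₀ : ℕ → List A → ℕ
only₀ c []      = c
only₀ c (_ ∷ _) = 0

only₁ : (A → ℕ) → List A → ℕ
only₁ f []       = 0
only₁ f (x ∷ xs) = only₀ (f x) xs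

only₂ : (A → A → ℕ) → List A → ℕ
only₂ f []       = 0
only₂ f (x ∷ xs) = only₁ (f x) xs

only₃ : (A → A → A → ℕ) → List A → ℕ
only₃ f []       = 0
only₃ f (x ∷ xs) = only₂ (f x) xs

∑-only₀ : (c : ℕ) (xs : List A) → ∑ (sublists xs) (only₀ c) ≡ c
∑-only₀ c []       = ℕ.+-identityʳ c
∑-only₀ c (x ∷ xs) = trans (∑-sublists-∷ (only₀ c) x xs)
  (cong₂ _+_ (∑-zero (λ _ → refl) (sublists xs)) (∑-only₀ c xs))

∑-only₁ : (f : A → ℕ) → ∀ xs → ∑ (sublists xs) (only₁ f) ≡ ∑ xs f
∑-only₁ f []       = refl
∑-only₁ f (x ∷ xs) = trans (∑-sublists-∷ (only₁ f) x xs)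
  (cong₂ _+_ (∑-only₀ (f x) xs) (∑-only₁ f xs))

∑-pairs : (f : A → A → ℕ) → ∀ xs → ∑ (pairs xs) (uncurry f) ≡ ∑ (sublists xs) (only₂ f)
∑-pairs f []       = refl
∑-pairs f (x ∷ xs) = begin
  ∑ (map (x ,_) xs ++ pairs xs) (uncurry f)
    ≡⟨ ∑-++ (uncurry f) (map (x ,_) xs) (pairs xs) ⟩
  ∑ (map (x ,_) xs) (uncurry f) + ∑ (pairs xs) (uncurry f)
    ≡⟨ cong₂ _+_ (trans (∑-map (uncurry f) (x ,_) xs) (sym (∑-only₁ (f x) xs))) (∑-pairs f xs) ⟩
  ∑ (sublists xs) (only₁ (f x)) + ∑ (sublists xs) (only₂ f)
    ≡⟨ ∑-sublists-∷ (only₂ f) x xs ⟨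
  ∑ (sublists (x ∷ xs)) (only₂ f) ∎

-- Each pair is met in its two orders: by symmetry the row and the column of the head contribute
-- equally, and the diagonal adds nothing.
2∑-only₂ : (f : A → A → ℕ) → (∀ x y → f x y ≡ f y x) → (∀ x → f x x ≡ 0) →
           ∀ xs → 2 · ∑ (sublists xs) (only₂ f) ≡ ∑ xs λ x → ∑ xs λ y → f x y
2∑-only₂ f f-sym f-irr []       = refl
2∑-only₂ f f-sym f-irr (x ∷ xs) = begin
  2 · ∑ (sublists (x ∷ xs)) (only₂ f)
    ≡⟨ cong (2 ·_) (∑-sublists-∷ (only₂ f) x xs) ⟩
  2 · (∑ (sublists xs) (only₁ (f x)) + ∑ (sublists xs) (only₂ f))
    ≡⟨ cong (λ s → 2 · (s + _)) (∑-only₁ (f x) xs) ⟩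
  2 · (∑ xs (f x) + ∑ (sublists xs) (only₂ f))
    ≡⟨ regroup (∑ xs (f x)) _ ⟩
  ∑ xs (f x) + (∑ xs (f x) + 2 · ∑ (sublists xs) (only₂ f))
    ≡⟨ cong (λ s → ∑ xs (f x) + (∑ xs (f x) + s)) (2∑-only₂ f f-sym f-irr xs) ⟩
  ∑ xs (f x) + (∑ xs (f x) + ∑ xs (λ y → ∑ xs (f y)))
    ≡⟨ cong₂ _+_ (cong (_+ ∑ xs (f x)) (sym (f-irr x)))
         (trans (cong (_+ _) (∑-cong (f-sym x) xs))
                (sym (∑-+ (λ y → f y x) (λ y → ∑ xs (f y)) xs))) ⟩
  f x x + ∑ xs (f x) + ∑ xs (λ y → f y x + ∑ xs (f y)) ∎
  where
  regroup : ∀ p q → 2 · (p + q) ≡ p + (p + 2 · q)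
  regroup = solve-∀

-- The two adjacent transpositions generate all six orders of a triple, and triples with a repeated
-- entry vanish. Triples through the head `x` reduce to `2∑-only₂` for `f x`; the three places that
-- `x` can take account for the factor 6 = 3 · 2.
6∑-only₃ : (f : A → A → A → ℕ) →
           (∀ x y z → f x y z ≡ f y x z) → (∀ x y z → f x y z ≡ f x z y) →
           (∀ x y → f x x y ≡ 0) →
           ∀ xs → 6 · ∑ (sublists xs) (only₃ f) ≡ ∑ xs λ x → ∑ xs λ y → ∑ xs λ z → f x y z
6∑-only₃ f swap₁₂ swap₂₃ f-irr []       = refl
6∑-only₃ f swap₁₂ swap₂₃ f-irr (x ∷ xs) = begin
  6 · ∑ (sublists (x ∷ xs)) (only₃ f)
    ≡⟨ cong (6 ·_) (∑-sublists-∷ (only₃ f) x xs) ⟩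
  6 · (∑ (sublists xs) (only₂ (f x)) + ∑ (sublists xs) (only₃ f))
    ≡⟨ regroup (∑ (sublists xs) (only₂ (f x))) _ ⟩
  3 · (2 · ∑ (sublists xs) (only₂ (f x))) + 6 · ∑ (sublists xs) (only₃ f)
    ≡⟨ cong₂ (λ s t → 3 · s + t) (2∑-only₂ (f x) (swap₂₃ x) f-irr₂ xs)
                                 (6∑-only₃ f swap₁₂ swap₂₃ f-irr xs) ⟩
  3 · p + q
    ≡⟨ regroup′ p q ⟩
  -- In order: triples starting with `x` twice, triples starting with `x` once, and triples starting
  -- in `xs`. The last group gives `p` for `x` in second place, `p` for `x` in third place, and `q`
  -- for triples that avoid `x`.
  0 + p + (p + (p + q))
    ≡⟨ cong₂ _+_ (cong₂ _+_ first second) third ⟨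
  ∑ (x ∷ xs) (λ z → f x x z) + ∑ xs (λ y → ∑ (x ∷ xs) (f x y))
    + ∑ xs (λ a → ∑ (x ∷ xs) λ b → ∑ (x ∷ xs) (f a b)) ∎
  where
  p q : ℕ
  p = ∑ xs λ y → ∑ xs λ z → f x y z
  q = ∑ xs λ a → ∑ xs λ b → ∑ xs λ c → f a b c

  regroup : ∀ s t → 6 · (s + t) ≡ 3 · (2 · s) + 6 · t
  regroup = solve-∀

  regroup′ : ∀ s t → 3 · s + t ≡ 0 + s + (s + (s + t))
  regroup′ = solve-∀

  f-irr₂ : ∀ {a} b → f a b b ≡ 0
  f-irr₂ {a} b = trans (swap₁₂ a b b) (trans (swap₂₃ b a b) (f-irr b a))

  first : ∑ (x ∷ xs) (λ z → f x x z) ≡ 0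
  first = ∑-zero (f-irr x) (x ∷ xs)

  second : ∑ xs (λ y → ∑ (x ∷ xs) (f x y)) ≡ p
  second = ∑-cong (λ y → cong (_+ ∑ xs (f x y)) (trans (swap₂₃ x y x) (f-irr x y))) xs

  third : ∑ xs (λ a → ∑ (x ∷ xs) λ b → ∑ (x ∷ xs) (f a b)) ≡ p + (p + q)
  third = begin
    ∑ xs (λ a → (f a x x + ∑ xs (f a x)) + ∑ xs (λ b → f a b x + ∑ xs (f a b)))
      ≡⟨ ∑-cong (λ a → cong₂ _+_
           (cong₂ _+_ (f-irr₂ x) (∑-cong (swap₁₂ a x) xs))
           (trans (∑-+ (λ b → f a b x) (λ b → ∑ xs (f a b)) xs)
                  (cong (_+ _) (∑-cong (λ b → trans (swap₂₃ a b x) (swap₁₂ a x b)) xs)))) xs ⟩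
    ∑ xs (λ a → ∑ xs (f x a) + (∑ xs (f x a) + ∑ xs (λ b → ∑ xs (f a b))))
      ≡⟨ ∑-+ (λ a → ∑ xs (f x a)) _ xs ⟩
    p + ∑ xs (λ a → ∑ xs (f x a) + ∑ xs (λ b → ∑ xs (f a b)))
      ≡⟨ cong (_+_ p) (∑-+ (λ a → ∑ xs (f x a)) _ xs) ⟩
    p + (p + q) ∎

-- Subsets of a finite set as lists of their elements

elements : ∀ {n} → Subset n → List (Fin n)
elements []            = []
elements (inside  ∷ K) = zero ∷ map suc (elements K)
elements (outside ∷ K) = map suc (elements K)

sublists-map : (g : A → B) → ∀ xs → sublists (map g xs) ≡ map (map g) (sublists xs)
sublists-map g []       = refl
sublists-map g (x ∷ xs) = begin
  map (g x ∷_) (sublists (map g xs)) ++ sublists (map g xs)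
    ≡⟨ cong (λ s → map (g x ∷_) s ++ s) (sublists-map g xs) ⟩
  map (g x ∷_) (map (map g) (sublists xs)) ++ map (map g) (sublists xs)
    ≡⟨ cong (_++ map (map g) (sublists xs)) (trans (sym (map-∘ (sublists xs))) (map-∘ (sublists xs))) ⟩
  map (map g) (map (x ∷_) (sublists xs)) ++ map (map g) (sublists xs)
    ≡⟨ map-++ (map g) (map (x ∷_) (sublists xs)) (sublists xs) ⟨
  map (map g) (map (x ∷_) (sublists xs) ++ sublists xs) ∎

-- Both enumerations put the sets containing the first element before the others, so they agree as
-- lists and not merely up to order.
map-elements-subsets : ∀ n → map elements (subsets n) ≡ sublists (allFin n)
map-elements-subsets zero    = refl
map-elements-subsets (suc n) = begin
  map elements (map (inside ∷_) S ++ (map (outside ∷_) S ++ []))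
    ≡⟨ cong (λ s → map elements (map (inside ∷_) S ++ s)) (++-identityʳ _) ⟩
  map elements (map (inside ∷_) S ++ map (outside ∷_) S)
    ≡⟨ map-++ elements (map (inside ∷_) S) _ ⟩
  map elements (map (inside ∷_) S) ++ map elements (map (outside ∷_) S)
    ≡⟨ cong₂ _++_ (trans (sym (map-∘ S)) (trans (map-∘ S) (cong (map (zero ∷_)) (map-∘ S))))
                  (trans (sym (map-∘ S)) (map-∘ S)) ⟩
  map (zero ∷_) (map (map suc) (map elements S)) ++ map (map suc) (map elements S)
    ≡⟨ cong (λ s → map (zero ∷_) s ++ s) (begin
         map (map suc) (map elements S)       ≡⟨ cong (map (map suc)) (map-elements-subsets n) ⟩
         map (map suc) (sublists (allFin n))  ≡⟨ sublists-map suc (allFin n) ⟨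
         sublists (map suc (allFin n))        ≡⟨ cong sublists (map-tabulate id suc) ⟩
         sublists (tabulate suc)              ∎) ⟩
  sublists (allFin (suc n)) ∎
  where S = subsets n

length-elements : ∀ {n} (K : Subset n) → length (elements K) ≡ ∣ K ∣
length-elements []            = refl
length-elements (inside  ∷ K) = cong suc (trans (length-map suc (elements K)) (length-elements K))
length-elements (outside ∷ K) = trans (length-map suc (elements K)) (length-elements K)

∣∩∣-elements : ∀ {n} (A K : Subset n) → ∣ A ∩ K ∣ ≡ ∑ (elements K) (λ i → 𝟙 (i ∈? A))
∣∩∣-elements []            []            = refl
∣∩∣-elements (inside  ∷ A) (inside  ∷ K) =
  cong suc (trans (∣∩∣-elements A K) (sym (∑-map _ suc (elements K))))
∣∩∣-elements (outside ∷ A) (inside  ∷ K) =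
  trans (∣∩∣-elements A K) (sym (∑-map _ suc (elements K)))
∣∩∣-elements (inside  ∷ A) (outside ∷ K) =
  trans (∣∩∣-elements A K) (sym (∑-map _ suc (elements K)))
∣∩∣-elements (outside ∷ A) (outside ∷ K) =
  trans (∣∩∣-elements A K) (sym (∑-map _ suc (elements K)))

∈-elements⁺ : ∀ {n} {K : Subset n} {i} → i ∈ₛ K → i ∈ elements K
∈-elements⁺ {K = inside  ∷ K} here       = here refl
∈-elements⁺ {K = inside  ∷ K} (there i∈) = there (∈-map⁺ suc (∈-elements⁺ i∈))
∈-elements⁺ {K = outside ∷ K} (there i∈) = ∈-map⁺ suc (∈-elements⁺ i∈)

∈-elements⁻ : ∀ {n} (K : Subset n) {i} → i ∈ elements K → i ∈ₛ K
∈-elements⁻ (inside  ∷ K) (here refl) = here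
∈-elements⁻ (inside  ∷ K) (there i∈) with ∈-map⁻ suc i∈
... | _ , j∈ , refl = there (∈-elements⁻ K j∈)
∈-elements⁻ (outside ∷ K) i∈ with ∈-map⁻ suc i∈
... | _ , j∈ , refl = there (∈-elements⁻ K j∈)

-- Topes, positive parts and coatoms

vecs-unique : {xs : List A} → Unique xs → ∀ n → Unique (vecs xs n)
vecs-unique xs! zero    = All.[] ∷ []
vecs-unique xs! (suc n) = Unique.cartesianProductWith⁺ _∷_ ∷-injective xs! (vecs-unique xs! n)

subsets-unique : ∀ n → Unique (subsets n)
subsets-unique = vecs-unique (((λ ()) All.∷ All.[]) ∷ (All.[] ∷ []))

signVecs-unique : ∀ n → Unique (signVecs n)
signVecs-unique = vecs-unique
  (((λ ()) All.∷ ((λ ()) All.∷ All.[])) ∷ (((λ ()) All.∷ All.[]) ∷ (All.[] ∷ [])))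

∈-vecs : {xs : List A} → (∀ x → x ∈ xs) → (X : Vec A n) → X ∈ vecs xs n
∈-vecs x∈ []      = here refl
∈-vecs x∈ (x ∷ X) = ∈-cartesianProductWith⁺ _∷_ (x∈ x) (∈-vecs x∈ X)

∈-subsets : (K : Subset n) → K ∈ subsets n
∈-subsets = ∈-vecs λ where
  inside  → here refl
  outside → there (here refl)

lookup-injective : {xs : List A} → Unique xs → ∀ i j →
                   List.lookup xs i ≡ List.lookup xs j → i ≡ j
lookup-injective (_ ∷ _)    zero    zero    _  = refl
lookup-injective (x∉ ∷ _)   zero    (suc j) eq = ⊥-elim (All.lookup x∉ (∈-lookup j) eq)
lookup-injective (x∉ ∷ _)   (suc i) zero    eq = ⊥-elim (All.lookup x∉ (∈-lookup i) (sym eq))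
lookup-injective (_ ∷ xs!)  (suc i) (suc j) eq = cong suc (lookup-injective xs! i j eq)

∁-∁ : (K : Subset n) → ∁ (∁ K) ≡ K
∁-∁ {n} = BooleanAlgebra.¬-involutive (∪-∩-booleanAlgebra n)

∁-∅ : ∁ (∅ {n}) ≡ full
∁-∅ {n} = BooleanAlgebra.¬⊥≈⊤ (∪-∩-booleanAlgebra n)

pairs-map : (g : A → B) → ∀ xs → pairs (map g xs) ≡ map (λ (x , y) → g x , g y) (pairs xs)
pairs-map g []       = refl
pairs-map g (x ∷ xs) = begin
  map (g x ,_) (map g xs) ++ pairs (map g xs)
    ≡⟨ cong₂ _++_ (trans (sym (map-∘ xs)) (map-∘ xs)) (pairs-map g xs) ⟩
  map (λ (x , y) → g x , g y) (map (x ,_) xs) ++ map (λ (x , y) → g x , g y) (pairs xs)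
    ≡⟨ map-++ _ (map (x ,_) xs) _ ⟨
  map (λ (x , y) → g x , g y) (pairs (x ∷ xs)) ∎

map-proj₁-toList : {R : Pred A 0ℓ} {xs : List A} (pxs : All.All R xs) →
                   map proj₁ (All.toList pxs) ≡ xs
map-proj₁-toList All.[]         = refl
map-proj₁-toList (px All.∷ pxs) = cong (_ ∷_) (map-proj₁-toList pxs)

𝟙*∑ : (p : Dec P) {R : Pred A 0ℓ} (R? : Decidable R) → ∀ xs →
      𝟙 p · ∑ xs (𝟙 ∘ R?) ≡ ∑ xs (λ x → 𝟙 (p ×-dec R? x))
𝟙*∑ (yes _) R? xs = ℕ.+-identityʳ _
𝟙*∑ (no _)  R? xs = sym (∑-zero (λ _ → refl) xs)

-- For a natural number t, 3 < 2t means t ≥ 2. So at most one of the three fails, which is to say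
-- that no two fail together.
majority : {P Q R : Set} (p : Dec P) (q : Dec Q) (r : Dec R) →
           (3 < 2 · (𝟙 p + (𝟙 q + (𝟙 r + 0)))) ⇔ ((P ⊎ Q) × (P ⊎ R) × (Q ⊎ R))
majority (yes p) (yes q) (yes r) = mk⇔ (λ _ → inj₁ p , inj₁ p , inj₁ q) (λ _ → s≤s (s≤s (s≤s (s≤s z≤n))))
majority (yes p) (yes q) (no _)  = mk⇔ (λ _ → inj₁ p , inj₁ p , inj₁ q) (λ _ → s≤s (s≤s (s≤s (s≤s z≤n))))
majority (yes p) (no _)  (yes r) = mk⇔ (λ _ → inj₁ p , inj₁ p , inj₂ r) (λ _ → s≤s (s≤s (s≤s (s≤s z≤n))))
majority (no _)  (yes q) (yes r) = mk⇔ (λ _ → inj₂ q , inj₂ r , inj₁ q) (λ _ → s≤s (s≤s (s≤s (s≤s z≤n))))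
majority (yes _) (no ¬q) (no ¬r) = mk⇔ (λ { (s≤s (s≤s ())) })
  λ { (_ , _ , inj₁ q) → ⊥-elim (¬q q) ; (_ , _ , inj₂ r) → ⊥-elim (¬r r) }
majority (no ¬p) (yes _) (no ¬r) = mk⇔ (λ { (s≤s (s≤s ())) })
  λ { (_ , inj₁ p , _) → ⊥-elim (¬p p) ; (_ , inj₂ r , _) → ⊥-elim (¬r r) }
majority (no ¬p) (no ¬q) r       = mk⇔ (λ lt → ⊥-elim (few r lt))
  λ { (inj₁ p , _) → ⊥-elim (¬p p) ; (inj₂ q , _) → ⊥-elim (¬q q) }
  where
  few : ∀ {R : Set} (r : Dec R) → ¬ (3 < 2 · (𝟙 r + 0))
  few (yes _) (s≤s (s≤s ()))
  few (no _)  ()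

-- Sign vectors and their positive parts

∈⁺⇒⊕ : (X : SignVec n) {e : Fin n} → e ∈ₛ X ⁺ → lookup X e ≡ ⊕
∈⁺⇒⊕ X = ∈⟦⟧⁻ (λ e → lookup X e ≟ ⊕)

⊕⇒∈⁺ : (X : SignVec n) {e : Fin n} → lookup X e ≡ ⊕ → e ∈ₛ X ⁺
⊕⇒∈⁺ X = ∈⟦⟧⁺ (λ e → lookup X e ≟ ⊕)

Nowhere𝟎 : Pred (SignVec n) 0ℓ
Nowhere𝟎 X = ∀ e → lookup X e ≢ 𝟎

∘ₛ-𝟎ˡ : ∀ {s t} → s ∘ₛ t ≡ 𝟎 → s ≡ 𝟎
∘ₛ-𝟎ˡ {𝟎} _ = refl

∘ₛ-𝟎ʳ : ∀ {s t} → s ∘ₛ t ≡ 𝟎 → t ≡ 𝟎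
∘ₛ-𝟎ʳ {𝟎} eq = eq

∘ₛ-⊕ : ∀ {s t} → s ≡ ⊕ → s ∘ₛ t ≡ ⊕
∘ₛ-⊕ refl = refl

∘ₛ-≼ : ∀ s t → s ≡ 𝟎 ⊎ s ≡ s ∘ₛ t
∘ₛ-≼ ⊕ t = inj₂ refl
∘ₛ-≼ ⊖ t = inj₂ refl
∘ₛ-≼ 𝟎 t = inj₁ refl

⊕-agree⇒≡ : ∀ {s t} → s ≢ 𝟎 → t ≢ 𝟎 → (s ≡ ⊕ → t ≡ ⊕) → (t ≡ ⊕ → s ≡ ⊕) → s ≡ t
⊕-agree⇒≡ {⊕}     _  _  st _  = sym (st refl)
⊕-agree⇒≡ {⊖} {⊕} _  _  _  ts = ts refl
⊕-agree⇒≡ {⊖} {⊖} _  _  _  _  = refl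
⊕-agree⇒≡ {⊖} {𝟎} _  t≢ _  _  = ⊥-elim (t≢ refl)
⊕-agree⇒≡ {𝟎}     s≢ _  _  _  = ⊥-elim (s≢ refl)

-- In the absence of zeros, every component outside the positive part is `⊖`.
⁺-injective : {X Y : SignVec n} → Nowhere𝟎 X → Nowhere𝟎 Y → X ⁺ ≡ Y ⁺ → X ≡ Y
⁺-injective {X = X} {Y} X≢ Y≢ eq = vec-ext λ e → ⊕-agree⇒≡ (X≢ e) (Y≢ e)
  (λ x → ∈⁺⇒⊕ Y (subst (e ∈ₛ_) eq (⊕⇒∈⁺ X x)))
  (λ y → ∈⁺⇒⊕ X (subst (e ∈ₛ_) (sym eq) (⊕⇒∈⁺ Y y)))

∁-⁺ : {X : SignVec n} → Nowhere𝟎 X → ∁ (X ⁺) ≡ (-ᵥ X) ⁺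
∁-⁺ {X = X} X≢ = ⊆-antisym
  (λ {e} e∈ → ⊕⇒∈⁺ (-ᵥ X) (trans (lookup-map e -ₛ_ X) (flip (X≢ e) (x∈∁p⇒x∉p e∈ ∘ ⊕⇒∈⁺ X))))
  (λ {e} e∈ → x∉p⇒x∈∁p λ e∈X → absurd (∈⁺⇒⊕ X e∈X) (trans (sym (lookup-map e -ₛ_ X)) (∈⁺⇒⊕ (-ᵥ X) e∈)))
  where
  flip : ∀ {s} → s ≢ 𝟎 → s ≢ ⊕ → -ₛ s ≡ ⊕
  flip {⊕} _ s≢ = ⊥-elim (s≢ refl)
  flip {⊖} _ _  = refl
  flip {𝟎} s≢ _ = ⊥-elim (s≢ refl)
  absurd : ∀ {s} → s ≡ ⊕ → -ₛ s ≢ ⊕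
  absurd refl ()

module _ (M : OrientedMatroid n) where
  open OrientedMatroid M

  Index : Set
  Index = Fin (length (topes M))

  indices : List Index
  indices = allFin (length (topes M))

  T⁺ T⁻ : Index → Subset n
  T⁺ i = tope M i ⁺
  T⁻ i = ∁ (T⁺ i)

  nowhere𝟎⇒tope : ∀ {X} → Covector X → Nowhere𝟎 X → Tope M X
  nowhere𝟎⇒tope c X≢ = c , λ Y _ X≼Y → vec-ext λ e → agree (X≢ e) (X≼Y e)
    where
    agree : ∀ {s t} → s ≢ 𝟎 → s ≡ 𝟎 ⊎ s ≡ t → s ≡ t
    agree s≢ (inj₁ s≡) = ⊥-elim (s≢ s≡)
    agree _  (inj₂ eq) = eq

  -- The covector `X` serves twice: it witnesses that its positive part is acyclic, and as a test
  -- covector it keeps every other element out of the convex hull.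
  ⁺-convex : ∀ {X} → Covector X → Convex M (X ⁺)
  ⁺-convex {X} c = convex-by M (acyclic⁺ M (X , c , λ _ → ∈⁺⇒⊕ X))
    λ b∈ → ⊕⇒∈⁺ X (∈⟦⟧⁻ (inConv? M (X ⁺)) b∈ X c λ _ → ∈⁺⇒⊕ X)

  tope-index : ∀ {T} → Tope M T → ∃ λ i → tope M i ≡ T
  tope-index {T} t = index T∈ , sym (lookup-index T∈)
    where
    T∈ : T ∈ topes M
    T∈ = ∈-filter⁺ (tope? M) (∈-signVecs T) t

  isTope : ∀ i → Tope M (tope M i)
  isTope i = proj₂ (∈-filter⁻ (tope? M) {xs = signVecs n} (∈-lookup i))

  map-proj₁-L̂-elements : map proj₁ (L̂-elements M) ≡ filter (inL̂? M) (subsets n)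
  map-proj₁-L̂-elements = map-proj₁-toList (all-filter (inL̂? M) (subsets n))

  module _ (no-loops : ∀ e → ¬ (∀ X → Covector X → lookup X e ≡ 𝟎)) where

    -- `no-loops` only refutes a universal statement; a finite search through the sign vectors
    -- extracts the witness.
    nonzero-at : ∀ e → ∃ λ X → Covector X × lookup X e ≢ 𝟎
    nonzero-at e = decidable-stable (anySignVec? λ X → covector? X ×-dec ¬? (lookup X e ≟ 𝟎))
      λ ∄ → no-loops e λ X c → decidable-stable (lookup X e ≟ 𝟎) λ X≢ → ∄ (X , c , X≢)

    -- If `T` vanished at `e`, composing it with a covector that is nonzero at `e` would give a
    -- strictly larger covector.
    tope⇒nowhere𝟎 : ∀ {T} → Tope M T → Nowhere𝟎 T
    tope⇒nowhere𝟎 {T} (c , maximal) e Te≡𝟎 with nonzero-at e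
    ... | X , d , X≢ = X≢ (∘ₛ-𝟎ʳ {lookup T e} (begin
      lookup T e ∘ₛ lookup X e  ≡⟨ lookup-zipWith _∘ₛ_ e T X ⟨
      lookup (T ∘ᵥ X) e         ≡⟨ cong (λ Y → lookup Y e) T≡T∘X ⟨
      lookup T e                ≡⟨ Te≡𝟎 ⟩
      𝟎                         ∎))
      where
      T≡T∘X : T ≡ T ∘ᵥ X
      T≡T∘X = maximal (T ∘ᵥ X) (comp-cov c d) λ f →
        subst (λ s → lookup T f ≡ 𝟎 ⊎ lookup T f ≡ s) (sym (lookup-zipWith _∘ₛ_ f T X))
              (∘ₛ-≼ (lookup T f) (lookup X f))

    -- A component of a composition vanishes only if it vanishes in both factors, so composing
    -- covectors accumulates their supports. Applied to `allFin n`, this yields a covector without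
    -- zeros.
    nonzero-on : (es : List (Fin n)) → ∃ λ X → Covector X × (∀ {e} → e ∈ es → lookup X e ≢ 𝟎)
    nonzero-on []       = replicate n 𝟎 , zero-cov , λ ()
    nonzero-on (e ∷ es) with nonzero-at e | nonzero-on es
    ... | X , c , X≢ | Y , d , Y≢ = X ∘ᵥ Y , comp-cov c d , λ where
      (here refl)    → X≢ ∘ ∘ₛ-𝟎ˡ ∘ trans (sym (lookup-zipWith _∘ₛ_ _ X Y))
      {f} (there f∈) → Y≢ f∈ ∘ ∘ₛ-𝟎ʳ {lookup X f} ∘ trans (sym (lookup-zipWith _∘ₛ_ f X Y))

    -- Composing `X` with a covector without zeros fills the zeros of `X`, which makes it a tope,
    -- and preserves every `⊕`.
    ⁺⊆tope⁺ : ∀ {X} → Covector X → ∃ λ i → X ⁺ ⊆ T⁺ i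
    ⁺⊆tope⁺ {X} c with nonzero-on (allFin n)
    ... | Y , d , Y≢ with tope-index (nowhere𝟎⇒tope (comp-cov c d)
            λ e → Y≢ (∈-allFin e) ∘ ∘ₛ-𝟎ʳ {lookup X e} ∘ trans (sym (lookup-zipWith _∘ₛ_ e X Y)))
    ... | i , eq = i , λ {e} e∈ → subst (λ T → e ∈ₛ T ⁺) (sym eq)
      (⊕⇒∈⁺ (X ∘ᵥ Y) (trans (lookup-zipWith _∘ₛ_ e X Y) (∘ₛ-⊕ (∈⁺⇒⊕ X e∈))))

    convex⊆tope⁺ : ∀ {C} → Convex M C → ∃ λ i → C ⊆ T⁺ i
    convex⊆tope⁺ (ac , _) with acyclic⁻ M ac
    ... | X , c , plus with ⁺⊆tope⁺ c
    ... | i , X⁺⊆ = i , λ e∈ → X⁺⊆ (⊕⇒∈⁺ X (plus _ e∈))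

    -- The positive part determines the tope, and the tope determines its index because `topes` has
    -- no duplicates.
    tope⁺-injective : ∀ {i j} → T⁺ i ≡ T⁺ j → i ≡ j
    tope⁺-injective {i} {j} eq =
      lookup-injective (Unique.filter⁺ (tope? M) (signVecs-unique n)) i j
        (⁺-injective (tope⇒nowhere𝟎 (isTope i)) (tope⇒nowhere𝟎 (isTope j)) eq)

    ∁-tope⁺-convex : ∀ i → Convex M (T⁻ i)
    ∁-tope⁺-convex i = subst (Convex M) (sym (∁-⁺ {X = tope M i} (tope⇒nowhere𝟎 (isTope i))))
                             (⁺-convex (neg-cov (proj₁ (isTope i))))

    module _ (¬acyclic : ¬ IsAcyclic M) where

      tope⁺≢full : ∀ i → T⁺ i ≢ full
      tope⁺≢full i eq = ¬acyclic (subst (Tope M) (vec-ext λ e →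
        trans (∈⁺⇒⊕ (tope M i) (subst (e ∈ₛ_) (sym eq) ∈⊤)) (sym (lookup-replicate e ⊕)))
        (isTope i))

      private
        -- Repeats the predicate inside the definition of `max⁺`, so that membership in `max⁺` can
        -- be opened and built with `∈⟦⟧⁻` and `∈⟦⟧⁺`.
        maximal? : Decidable λ i → ∀ j → T⁺ i ⊆ T⁺ j → T⁺ i ≡ T⁺ j
        maximal? i = all? λ j → (T⁺ i ⊆? T⁺ j) →-dec (T⁺ i ≡ᵈ T⁺ j)

      -- A member of the lattice strictly between the positive part and `full` would be convex,
      -- hence contained in the positive part of some tope, against maximality.
      max⁺⇒coatom : ∀ {i} → i ∈ₛ max⁺ M → _∈L̂ᶜ M (T⁺ i)
      max⁺⇒coatom {i} i∈ = inj₁ (⁺-convex (proj₁ (isTope i))) , tt , (⊆⊤ , tope⁺≢full i) , between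
        where
        between : ∀ (W : ∃ (InL̂ M)) → _ → ¬ ((T⁺ i ⊆ proj₁ W × T⁺ i ≢ proj₁ W) ×
                                            (proj₁ W ⊆ full × proj₁ W ≢ full))
        between (W , inj₂ W≡full) _ (_ , _ , W≢full) = W≢full W≡full
        between (W , inj₁ cW) _ ((⊆W , ≢W) , _) with convex⊆tope⁺ cW
        ... | j , W⊆ = ≢W (⊆-antisym ⊆W λ e∈ →
          subst (_ ∈ₛ_) (sym (∈⟦⟧⁻ maximal? i∈ j (W⊆ ∘ ⊆W))) (W⊆ e∈))

      -- Since `M` is not acyclic, the positive part of any tope is a proper member of the lattice;
      -- a strictly larger one would lie between the coatom and the top.
      coatom⇒max⁺ : ∀ {i} → _∈L̂ᶜ M (T⁺ i) → i ∈ₛ max⁺ M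
      coatom⇒max⁺ {i} (_ , _ , _ , between) = ∈⟦⟧⁺ maximal? λ j ⊆j →
        decidable-stable (T⁺ i ≡ᵈ T⁺ j) λ ≢j →
          between (T⁺ j , inj₁ (⁺-convex (proj₁ (isTope j)))) tt
                  ((⊆j , ≢j) , (⊆⊤ , tope⁺≢full j))

      -- A coatom is convex, so some tope is positive on all of it. The positive part of that tope
      -- is still below the top and cannot be strictly larger than the coatom.
      coatom-tope : ∀ {C} → _∈L̂ᶜ M C → ∃ λ i → T⁺ i ≡ C
      coatom-tope (inj₂ C≡full , _ , (_ , C≢full) , _) = ⊥-elim (C≢full C≡full)
      coatom-tope {C} (inj₁ cC , _ , _ , between) with convex⊆tope⁺ cC
      ... | i , C⊆ = i , sym (decidable-stable (C ≡ᵈ T⁺ i) λ C≢ →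
        between (T⁺ i , inj₁ (⁺-convex (proj₁ (isTope i)))) tt
                ((C⊆ , C≢) , (⊆⊤ , tope⁺≢full i)))

      -- The graph on max⁺ and its triangles

      -- Phrased through `𝒯⁺`, as in `Committee`, so that three such conditions are literally what
      -- `majority` delivers at each `e`.
      Covers : Index → Index → Set
      Covers i j = ∀ e → i ∈ₛ 𝒯⁺ M e ⊎ j ∈ₛ 𝒯⁺ M e

      Adjacent : Index → Index → Set
      Adjacent i j = i ∈ₛ max⁺ M × j ∈ₛ max⁺ M × Covers i j

      adjacent? : ∀ i j → Dec (Adjacent i j)
      adjacent? i j = (i ∈? max⁺ M) ×-dec (j ∈? max⁺ M) ×-dec
                      all? λ e → (i ∈? 𝒯⁺ M e) ⊎-dec (j ∈? 𝒯⁺ M e)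

      adjacent-sym : ∀ {i j} → Adjacent i j → Adjacent j i
      adjacent-sym (i∈ , j∈ , covers) = j∈ , i∈ , swap ∘ covers

      ∈𝒯⁺⇒∈tope⁺ : ∀ {i e} → i ∈ₛ 𝒯⁺ M e → e ∈ₛ T⁺ i
      ∈𝒯⁺⇒∈tope⁺ {i} {e} i∈ = ⊕⇒∈⁺ (tope M i) (∈⟦⟧⁻ (λ i → lookup (tope M i) e ≟ ⊕) i∈)

      ∈tope⁺⇒∈𝒯⁺ : ∀ {i e} → e ∈ₛ T⁺ i → i ∈ₛ 𝒯⁺ M e
      ∈tope⁺⇒∈𝒯⁺ {i} {e} e∈ = ∈⟦⟧⁺ (λ i → lookup (tope M i) e ≟ ⊕) (∈⁺⇒⊕ (tope M i) e∈)

      adjacent-irrefl : ∀ {i} → ¬ Adjacent i i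
      adjacent-irrefl {i} (_ , _ , covers) =
        tope⁺≢full i (⊆-antisym ⊆⊤ λ {e} _ → ∈𝒯⁺⇒∈tope⁺ (reduce (covers e)))

      Triangle : (i j k : Index) → Set
      Triangle i j k = Adjacent i j × Adjacent i k × Adjacent j k

      triangle? : ∀ i j k → Dec (Triangle i j k)
      triangle? i j k = adjacent? i j ×-dec adjacent? i k ×-dec adjacent? j k

      triangles : List Index → ℕ
      triangles = only₃ λ i j k → 𝟙 (triangle? i j k)

      -- Once the three members are listed, the number of votes for `e` is a sum of three
      -- indicators, and `majority` turns the committee condition at `e` into the three covering
      -- conditions at `e`.
      maxCommittee⇔triangle : ∀ {K i j k} → elements K ≡ i ∷ j ∷ k ∷ [] →
                              MaxCommittee₃ M K ⇔ Triangle i j k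
      maxCommittee⇔triangle {K} {i} {j} {k} eq = mk⇔ to from
        where
        ∣K∣≡3 : ∣ K ∣ ≡ 3
        ∣K∣≡3 = trans (sym (length-elements K)) (cong length eq)

        votes : ∀ e → (∣ K ∣ < 2 · ∣ 𝒯⁺ M e ∩ K ∣) ≡
                      (3 < 2 · (𝟙 (i ∈? 𝒯⁺ M e) + (𝟙 (j ∈? 𝒯⁺ M e) + (𝟙 (k ∈? 𝒯⁺ M e) + 0))))
        votes e = cong₂ (λ s t → s < 2 · t) ∣K∣≡3
          (trans (∣∩∣-elements (𝒯⁺ M e) K) (cong (λ xs → ∑ xs λ i → 𝟙 (i ∈? 𝒯⁺ M e)) eq))

        maj : ∀ e → _
        maj e = majority (i ∈? 𝒯⁺ M e) (j ∈? 𝒯⁺ M e) (k ∈? 𝒯⁺ M e)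

        member : ∀ {l} → l ∈ i ∷ j ∷ k ∷ [] → l ∈ₛ K
        member l∈ = ∈-elements⁻ K (subst (_ ∈_) (sym eq) l∈)

        to : MaxCommittee₃ M K → Triangle i j k
        to ((committee , _) , K⊆) =
            (i∈ , j∈ , proj₁ ∘ pos) , (i∈ , k∈ , proj₁ ∘ proj₂ ∘ pos) , (j∈ , k∈ , proj₂ ∘ proj₂ ∘ pos)
          where
          i∈ = K⊆ (member (here refl))
          j∈ = K⊆ (member (there (here refl)))
          k∈ = K⊆ (member (there (there (here refl))))
          pos : ∀ e → _
          pos e = Equivalence.to (maj e) (subst id (votes e) (committee e))

        from : Triangle i j k → MaxCommittee₃ M K
        from ((i∈ , j∈ , ij) , (_ , k∈ , ik) , (_ , _ , jk)) =
          ((λ e → subst id (sym (votes e)) (Equivalence.from (maj e) (ij e , ik e , jk e))) , ∣K∣≡3) ,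
          λ l∈ → all∈ (subst (_ ∈_) eq (∈-elements⁺ l∈))
          where
          all∈ : ∀ {l} → l ∈ i ∷ j ∷ k ∷ [] → l ∈ₛ max⁺ M
          all∈ (here refl)                 = i∈
          all∈ (there (here refl))         = j∈
          all∈ (there (there (here refl))) = k∈

      maxCommittee⇒length : ∀ {K xs} → elements K ≡ xs → MaxCommittee₃ M K → length xs ≡ 3
      maxCommittee⇒length {K} refl ((_ , ∣K∣≡3) , _) = trans (length-elements K) ∣K∣≡3

      -- For sets of any other size both sides are 0: the left by the cardinality condition, the
      -- right because `only₃` vanishes there.
      𝟙-maxCommittee : ∀ K → 𝟙 (maxCommittee₃? M K) ≡ triangles (elements K)
      𝟙-maxCommittee K with elements K in eq
      ... | []                = 𝟙-zero ((λ ()) ∘ maxCommittee⇒length eq) (maxCommittee₃? M K)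
      ... | _ ∷ []            = 𝟙-zero ((λ ()) ∘ maxCommittee⇒length eq) (maxCommittee₃? M K)
      ... | _ ∷ _ ∷ []        = 𝟙-zero ((λ ()) ∘ maxCommittee⇒length eq) (maxCommittee₃? M K)
      ... | i ∷ j ∷ k ∷ []    = 𝟙-cong (maxCommittee⇔triangle eq) (maxCommittee₃? M K) (triangle? i j k)
      ... | _ ∷ _ ∷ _ ∷ _ ∷ _ = 𝟙-zero ((λ ()) ∘ maxCommittee⇒length eq) (maxCommittee₃? M K)

      orderedTriangles : ℕ
      orderedTriangles = ∑ indices λ i → ∑ indices λ j → ∑ indices λ k → 𝟙 (triangle? i j k)

      committees : ℕ
      committees = length (filter (maxCommittee₃? M) (subsets (length (topes M))))

      6*committees : 6 · committees ≡ orderedTriangles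
      6*committees = begin
        6 · committees
          ≡⟨ cong (6 ·_) (length-filter (maxCommittee₃? M) (subsets _)) ⟩
        6 · ∑ (subsets _) (𝟙 ∘ maxCommittee₃? M)
          ≡⟨ cong (6 ·_) (∑-cong 𝟙-maxCommittee (subsets _)) ⟩
        6 · ∑ (subsets _) (triangles ∘ elements)
          ≡⟨ cong (6 ·_) (∑-map triangles elements (subsets _)) ⟨
        6 · ∑ (map elements (subsets _)) triangles
          ≡⟨ cong (λ xss → 6 · ∑ xss triangles) (map-elements-subsets _) ⟩
        6 · ∑ (sublists indices) triangles
          ≡⟨ 6∑-only₃ (λ i j k → 𝟙 (triangle? i j k))
               (λ i j k → 𝟙-cong (mk⇔ swap₁₂ swap₁₂) (triangle? i j k) (triangle? j i k))
               (λ i j k → 𝟙-cong (mk⇔ swap₂₃ swap₂₃) (triangle? i j k) (triangle? i k j))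
               (λ i k → 𝟙-zero (adjacent-irrefl ∘ proj₁) (triangle? i i k)) indices ⟩
        orderedTriangles ∎
        where
        swap₁₂ : ∀ {i j k} → Triangle i j k → Triangle j i k
        swap₁₂ (ij , ik , jk) = adjacent-sym ij , jk , ik
        swap₂₃ : ∀ {i j k} → Triangle i j k → Triangle i k j
        swap₂₃ (ij , ik , jk) = ik , ij , adjacent-sym jk

      -- The sum over pairs of convex sets

      Above : Subset n → Subset n → Pred (Subset n) 0ℓ
      Above A B C = _∈L̂ᶜ M C × A ⊆ C × B ⊆ C

      above? : ∀ A B → Decidable (Above A B)
      above? A B C = (_∈L̂ᶜ? M C) ×-dec (A ⊆? C) ×-dec (B ⊆? C)

      DisjointPair : Subset n → Subset n → Set
      DisjointPair A B = _∈L̂ᶜ M (∁ A) × _∈L̂ᶜ M (∁ B) × A ∩ B ≡ ∅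

      disjointPair? : ∀ A B → Dec (DisjointPair A B)
      disjointPair? A B = (_∈L̂ᶜ? M (∁ A)) ×-dec (_∈L̂ᶜ? M (∁ B)) ×-dec ((A ∩ B) ≡ᵈ ∅)

      Summand : (A B C : Subset n) → Set
      Summand A B C = DisjointPair A B × Above A B C

      summand? : ∀ A B C → Dec (Summand A B C)
      summand? A B C = disjointPair? A B ×-dec above? A B C

      L̂-subsets : List (Subset n)
      L̂-subsets = filter (inL̂? M) (subsets n)

      L̂-subsets-unique : Unique L̂-subsets
      L̂-subsets-unique = Unique.filter⁺ (inL̂? M) (subsets-unique n)

      ∈-L̂-subsets : ∀ {A} → Convex M A → A ∈ L̂-subsets
      ∈-L̂-subsets {A} c = ∈-filter⁺ (inL̂? M) (∈-subsets A) (inj₁ c)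

      open BoundedLattice (L̂ M) using (_∨_; x≤x∨y; y≤x∨y; ∨-least)

      -- Whatever lies above `C` also lies above the join, so being covered by the top means the
      -- same in the interval as in the whole lattice. Containing the join amounts to containing
      -- both sets, which removes the join from the count.
      joinCoatom⇔above : ∀ D₁ D₂ C → [_,1̂]ᶜ M (D₁ ∨ D₂) C ⇔ Above (proj₁ D₁) (proj₁ D₂) (proj₁ C)
      joinCoatom⇔above D₁ D₂ C = mk⇔
        (λ ((∨⊆C , _) , C⊏ , between) →
          (proj₂ C , tt , C⊏ , λ W _ (C⊏W , W⊏) → between W ((λ e∈ → proj₁ C⊏W (∨⊆C e∈)) , ⊆⊤) (C⊏W , W⊏)) ,
          (λ e∈ → ∨⊆C (x≤x∨y D₁ D₂ e∈)) , (λ e∈ → ∨⊆C (y≤x∨y D₁ D₂ e∈)))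
        (λ ((_ , _ , C⊏ , between) , D₁⊆C , D₂⊆C) →
          ((λ e∈ → ∨-least {D₁} {D₂} {C} D₁⊆C D₂⊆C e∈) , ⊆⊤) , C⊏ , λ W _ → between W tt)

      -- Disjointness of two negative parts, and inclusion of one negative part in another positive
      -- part, express the same thing: no element is negative in both topes. These are the three
      -- edges of the triangle.
      summand⇔triangle : ∀ i j k → Summand (T⁻ i) (T⁻ j) (T⁺ k) ⇔ Triangle i j k
      summand⇔triangle i j k = mk⇔ to from
        where
        to : Summand (T⁻ i) (T⁻ j) (T⁺ k) → Triangle i j k
        to ((ci , cj , disj) , ck , i⊆k , j⊆k) =
          (i∈ , j∈ , λ e → cover λ e∈i e∈j → ∉⊥ (subst (e ∈ₛ_) disj (x∈p∩q⁺ (e∈i , e∈j)))) ,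
          (i∈ , k∈ , λ e → cover λ e∈i e∈k → x∈∁p⇒x∉p e∈k (i⊆k e∈i)) ,
          (j∈ , k∈ , λ e → cover λ e∈j e∈k → x∈∁p⇒x∉p e∈k (j⊆k e∈j))
          where
          i∈ = coatom⇒max⁺ (subst (_∈L̂ᶜ M) (∁-∁ _) ci)
          j∈ = coatom⇒max⁺ (subst (_∈L̂ᶜ M) (∁-∁ _) cj)
          k∈ = coatom⇒max⁺ ck
          cover : ∀ {i j e} → (e ∈ₛ T⁻ i → ¬ e ∈ₛ T⁻ j) → i ∈ₛ 𝒯⁺ M e ⊎ j ∈ₛ 𝒯⁺ M e
          cover {i} {j} {e} h with e ∈? T⁺ i
          ... | yes e∈i = inj₁ (∈tope⁺⇒∈𝒯⁺ e∈i)
          ... | no  e∉i = inj₂ (∈tope⁺⇒∈𝒯⁺ (x∉∁p⇒x∈p (h (x∉p⇒x∈∁p e∉i))))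

        from : Triangle i j k → Summand (T⁻ i) (T⁻ j) (T⁺ k)
        from ((i∈ , j∈ , ij) , (_ , k∈ , ik) , (_ , _ , jk)) =
          (subst (_∈L̂ᶜ M) (sym (∁-∁ _)) (max⁺⇒coatom i∈) ,
           subst (_∈L̂ᶜ M) (sym (∁-∁ _)) (max⁺⇒coatom j∈) ,
           ⊆-antisym (λ e∈ → let e∈i , e∈j = x∈p∩q⁻ _ _ e∈ in
                             ⊥-elim (x∈∁p⇒x∉p e∈j (uncover ij e∈i))) ⊥⊆) ,
          max⁺⇒coatom k∈ , uncover ik , uncover jk
          where
          uncover : ∀ {i j} → Covers i j → T⁻ i ⊆ T⁺ j
          uncover ij {e} e∈ with ij e
          ... | inj₁ i∈ = ⊥-elim (x∈∁p⇒x∉p e∈ (∈𝒯⁺⇒∈tope⁺ i∈))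
          ... | inj₂ j∈ = ∈𝒯⁺⇒∈tope⁺ j∈

      -- The indices may run over all topes: one outside `max⁺` does not give a coatom, so `f` is 0
      -- there.
      ∑-coatoms : (f : Subset n → ℕ) → (∀ {C} → ¬ _∈L̂ᶜ M C → f C ≡ 0) →
                  ∑ L̂-subsets f ≡ ∑ indices λ i → f (T⁺ i)
      ∑-coatoms f f-zero = ∑-reindex f T⁺ L̂-subsets-unique (Unique.allFin⁺ _)
        tope⁺-injective (λ i _ → ∈-L̂-subsets (⁺-convex (proj₁ (isTope i)))) support
        where
        support : ∀ C → (∃ λ i → i ∈ indices × T⁺ i ≡ C) ⊎ f C ≡ 0
        support C with _∈L̂ᶜ? M C
        ... | no ¬c = inj₂ (f-zero ¬c)
        ... | yes c with coatom-tope c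
        ... | i , eq = inj₁ (i , ∈-allFin i , eq)

      ∑-∁coatoms : (f : Subset n → ℕ) → (∀ {A} → ¬ _∈L̂ᶜ M (∁ A) → f A ≡ 0) →
                   ∑ L̂-subsets f ≡ ∑ indices λ i → f (T⁻ i)
      ∑-∁coatoms f f-zero = ∑-reindex f T⁻ L̂-subsets-unique (Unique.allFin⁺ _)
        (tope⁺-injective ∘ ∁-injective) (λ i _ → ∈-L̂-subsets (∁-tope⁺-convex i)) support
        where
        ∁-injective : ∀ {A B : Subset n} → ∁ A ≡ ∁ B → A ≡ B
        ∁-injective {A} {B} eq = trans (sym (∁-∁ A)) (trans (cong ∁ eq) (∁-∁ B))

        support : ∀ A → (∃ λ i → i ∈ indices × T⁻ i ≡ A) ⊎ f A ≡ 0
        support A with _∈L̂ᶜ? M (∁ A)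
        ... | no ¬c = inj₂ (f-zero ¬c)
        ... | yes c with coatom-tope c
        ... | i , eq = inj₁ (i , ∈-allFin i , trans (cong ∁ eq) (∁-∁ A))

      -- The term of the pair in the stated sum, extended by 0 to inadmissible pairs, and depending
      -- only on the underlying subsets; see `𝟙*joinCoatoms`.
      weight : Subset n → Subset n → ℕ
      weight A B = ∑ L̂-subsets λ C → 𝟙 (summand? A B C)

      weight-sym : ∀ A B → weight A B ≡ weight B A
      weight-sym A B = ∑-cong (λ C → 𝟙-cong (mk⇔ flip flip) (summand? A B C) (summand? B A C)) L̂-subsets
        where
        flip : ∀ {A B C} → Summand A B C → Summand B A C
        flip {A} {B} ((a , b , disj) , c , A⊆ , B⊆) = (b , a , trans (∩-comm B A) disj) , c , B⊆ , A⊆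

      -- A set disjoint from itself is empty, and its complement `full` is not a coatom. Hence the
      -- diagonal may be included when passing to ordered pairs.
      weight-irrefl : ∀ A → weight A A ≡ 0
      weight-irrefl A = ∑-zero (λ C → 𝟙-zero absurd (summand? A A C)) L̂-subsets
        where
        absurd : ∀ {C} → ¬ Summand A A C
        absurd (((_ , _ , (_ , ∁A≢full) , _) , _ , A∩A≡∅) , _) =
          ∁A≢full (trans (cong ∁ (trans (sym (∩-idem A)) A∩A≡∅)) ∁-∅)

      ∑-weight : ∑ L̂-subsets (λ A → ∑ L̂-subsets λ B → weight A B) ≡ orderedTriangles
      ∑-weight = begin
        ∑ L̂-subsets (λ A → ∑ L̂-subsets λ B → weight A B)
          ≡⟨ ∑-∁coatoms _ (λ {A} ¬c → ∑-zero (λ B → ∑-zero (λ C →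
               𝟙-zero (¬c ∘ proj₁ ∘ proj₁) (summand? A B C)) L̂-subsets) L̂-subsets) ⟩
        ∑ indices (λ i → ∑ L̂-subsets λ B → weight (T⁻ i) B)
          ≡⟨ ∑-cong (λ i → ∑-∁coatoms (weight (T⁻ i)) λ {B} ¬c → ∑-zero (λ C →
               𝟙-zero (¬c ∘ proj₁ ∘ proj₂ ∘ proj₁) (summand? (T⁻ i) B C)) L̂-subsets) indices ⟩
        ∑ indices (λ i → ∑ indices λ j → weight (T⁻ i) (T⁻ j))
          ≡⟨ ∑-cong (λ i → ∑-cong (λ j → ∑-coatoms (λ C → 𝟙 (summand? (T⁻ i) (T⁻ j) C)) λ {C} ¬c →
               𝟙-zero (¬c ∘ proj₁ ∘ proj₂) (summand? (T⁻ i) (T⁻ j) C)) indices) indices ⟩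
        ∑ indices (λ i → ∑ indices λ j → ∑ indices λ k → 𝟙 (summand? (T⁻ i) (T⁻ j) (T⁺ k)))
          ≡⟨ ∑-cong (λ i → ∑-cong (λ j → ∑-cong (λ k →
               𝟙-cong (summand⇔triangle i j k) (summand? (T⁻ i) (T⁻ j) (T⁺ k)) (triangle? i j k))
               indices) indices) indices ⟩
        orderedTriangles ∎

      joinCoatoms : ∃ (InL̂ M) × ∃ (InL̂ M) → ℕ
      joinCoatoms = λ (D₁ , D₂) → length (filter ([_,1̂]ᶜ? M (D₁ ∨ D₂)) (L̂-elements M))

      𝟙*joinCoatoms : ∀ D → 𝟙 (summationPair? M D) · joinCoatoms D ≡ weight (proj₁ (proj₁ D)) (proj₁ (proj₂ D))
      𝟙*joinCoatoms (D₁@(A , _) , D₂@(B , _)) = begin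
        -- `summationPair?` at this pair unfolds to `disjointPair? A B`.
        𝟙 (disjointPair? A B) · joinCoatoms (D₁ , D₂)
          ≡⟨ cong (𝟙 (disjointPair? A B) ·_) (length-filter ([_,1̂]ᶜ? M (D₁ ∨ D₂)) (L̂-elements M)) ⟩
        𝟙 (disjointPair? A B) · ∑ (L̂-elements M) (𝟙 ∘ [_,1̂]ᶜ? M (D₁ ∨ D₂))
          ≡⟨ cong (𝟙 (disjointPair? A B) ·_) (∑-cong (λ C → 𝟙-cong (joinCoatom⇔above D₁ D₂ C)
               ([_,1̂]ᶜ? M (D₁ ∨ D₂) C) (above? A B (proj₁ C))) (L̂-elements M)) ⟩
        𝟙 (disjointPair? A B) · ∑ (L̂-elements M) (𝟙 ∘ above? A B ∘ proj₁)
          ≡⟨ cong (𝟙 (disjointPair? A B) ·_) (∑-map (𝟙 ∘ above? A B) proj₁ (L̂-elements M)) ⟨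
        𝟙 (disjointPair? A B) · ∑ (map proj₁ (L̂-elements M)) (𝟙 ∘ above? A B)
          ≡⟨ cong (λ xs → 𝟙 (disjointPair? A B) · ∑ xs (𝟙 ∘ above? A B)) map-proj₁-L̂-elements ⟩
        𝟙 (disjointPair? A B) · ∑ L̂-subsets (𝟙 ∘ above? A B)
          ≡⟨ 𝟙*∑ (disjointPair? A B) (above? A B) L̂-subsets ⟩
        weight A B ∎

      pairSum : ℕ
      pairSum = sum (map joinCoatoms (filter (summationPair? M) (pairs (L̂-elements M))))

      2*pairSum : 2 · pairSum ≡ orderedTriangles
      2*pairSum = begin
        2 · pairSum
          ≡⟨ cong (2 ·_) (∑-filter (summationPair? M) joinCoatoms (pairs (L̂-elements M))) ⟩
        2 · ∑ (pairs (L̂-elements M)) (λ D → 𝟙 (summationPair? M D) · joinCoatoms D)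
          ≡⟨ cong (2 ·_) (∑-cong 𝟙*joinCoatoms (pairs (L̂-elements M))) ⟩
        2 · ∑ (pairs (L̂-elements M)) (λ (D₁ , D₂) → weight (proj₁ D₁) (proj₁ D₂))
          ≡⟨ cong (2 ·_) (∑-map (uncurry weight) _ (pairs (L̂-elements M))) ⟨
        -- The membership proofs are dropped from here on, because the reindexing by topes needs a
        -- duplicate-free list of plain subsets.
        2 · ∑ (map (λ (D₁ , D₂) → proj₁ D₁ , proj₁ D₂) (pairs (L̂-elements M))) (uncurry weight)
          ≡⟨ cong (λ xs → 2 · ∑ xs (uncurry weight)) (pairs-map proj₁ (L̂-elements M)) ⟨
        2 · ∑ (pairs (map proj₁ (L̂-elements M))) (uncurry weight)
          ≡⟨ cong (λ xs → 2 · ∑ (pairs xs) (uncurry weight)) map-proj₁-L̂-elements ⟩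
        2 · ∑ (pairs L̂-subsets) (uncurry weight)
          ≡⟨ cong (2 ·_) (∑-pairs weight L̂-subsets) ⟩
        2 · ∑ (sublists L̂-subsets) (only₂ weight)
          ≡⟨ 2∑-only₂ weight weight-sym weight-irrefl L̂-subsets ⟩
        ∑ L̂-subsets (λ A → ∑ L̂-subsets λ B → weight A B)
          ≡⟨ ∑-weight ⟩
        orderedTriangles ∎

      pairSum≡3*committees : pairSum ≡ 3 · committees
      pairSum≡3*committees = ℕ.*-cancelˡ-≡ pairSum (3 · committees) 2 (begin
        2 · pairSum           ≡⟨ 2*pairSum ⟩
        orderedTriangles      ≡⟨ 6*committees ⟨
        6 · committees        ≡⟨ ℕ.*-assoc 2 3 committees ⟩
        2 · (3 · committees)  ∎)

-- A fraction with a variable numerator does not normalise by computation, so the identity is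
-- verified by cross multiplication of unnormalised rationals.
third-of-triple : ∀ c → + c / 1 ≡ + 1 / 3 * (+ (3 · c) / 1)
third-of-triple c = toℚᵘ-injective (ℚᵘ.≃-trans (toℚᵘ-fromℚᵘ (mkℚᵘ (+ c) 0))
  (ℚᵘ.≃-trans (*≡* (begin
    + c ℤ* + 3                 ≡⟨ ℤ.pos-* c 3 ⟨
    + (c · 3)                  ≡⟨ cong +_ (ℕ.*-comm c 3) ⟩
    + (3 · c)                  ≡⟨ ℤ.*-identityˡ (+ (3 · c)) ⟨
    + 1 ℤ* + (3 · c)           ≡⟨ ℤ.*-identityʳ (+ 1 ℤ* + (3 · c)) ⟨
    + 1 ℤ* + (3 · c) ℤ* + 1    ∎))
  (ℚᵘ.≃-sym (ℚᵘ.≃-trans (toℚᵘ-homo-* (+ 1 / 3) (+ (3 · c) / 1))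
    -- The second argument of `mkℚᵘ` is the denominator minus one, so `mkℚᵘ (+ 1) 2` is one third.
    (ℚᵘ.*-congˡ {mkℚᵘ (+ 1) 2} (toℚᵘ-fromℚᵘ (mkℚᵘ (+ (3 · c)) 0)))))))

proposition3p1 : ∀ {n : ℕ} (M : OrientedMatroid n) → Simple M → ¬ IsAcyclic M →
    let open BoundedLattice (L̂ M) using (_∨_) in
    + length (filter (maxCommittee₃? M) (subsets (length (topes M)))) / 1
    ≡ + 1 / 3 * (+ sum (map (λ (D₁ , D₂) → length (filter ([_,1̂]ᶜ? M (D₁ ∨ D₂)) (L̂-elements M)))
    (filter (summationPair? M) (pairs (L̂-elements M)))) / 1)
proposition3p1 M simple ¬acyclic = trans (third-of-triple (committees M no-loops ¬acyclic))
  (cong (λ s → + 1 / 3 * (+ s / 1)) (sym (pairSum≡3*committees M no-loops ¬acyclic)))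
  where open Simple simple using (no-loops)
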